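{- For $n\ge1$ let $\widehat{B}_n(x,y)=\sum_{\sigma\in\mathcal{B}_n}x^{\mathrm{des}_1\sigma}y^{\mathrm{asc}_0\sigma}$ and let $\alpha=(1-x)(1-y)$. Then $$\sum_{n\geq 1}\widehat{B}_{2n}(x,y)\frac{t^{2n}}{(2n)!}=\frac{(1+xy)\sum_{n\geq 0}\frac{(-\alpha)^n (2t)^{2n}}{(2n)!}+\sum_{n\geq 0}\frac{(-\alpha)^{n+1} t^{2n}}{(2n)!}-(x+y)}{(x+y)-(1+xy)\sum_{n\geq 0}\frac{(-\alpha)^n (2t)^{2n}}{(2n)!}}$$ and $$\sum_{n\geq 1}\widehat{B}_{2n-1}(x,y)\frac{t^{2n-1}}{(2n-1)!}=\frac{(1+y)\,\sum_{n\geq 0}\frac{(-\alpha)^{n+1} t^{2n+1}}{(2n+1)!}}{(x+y)-(1+xy)\sum_{n\geq 0}\frac{(-\alpha)^n (2t)^{2n}}{(2n)!}}.$$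
   Context: $\mathcal{B}_n$ is the set of signed permutations, i.e. bijections $\sigma$ of $\{\pm1,\dots,\pm n\}$ with $\sigma(-i)=-\sigma(i)$; each $\sigma$ is identified with the word $\sigma(0)\sigma(1)\cdots\sigma(n)$ where $\sigma(0)=0$. A position $i\in\{0,1,\dots,n-1\}$ is a descent if $\sigma(i)>\sigma(i+1)$ and an ascent if $\sigma(i)<\sigma(i+1)$. $\mathrm{des}_1\sigma$ is the number of descents at odd positions and $\mathrm{asc}_0\sigma$ the number of ascents at even positions (including position $0$). -}

module Defs where

open import Level using (Level)
open import Data.Bool using (Bool; true; false; if_then_else_; _∧_; not)
open import Data.Nat using (ℕ; zero; suc; _∸_; ⌊_/2⌋; _^_)
  renaming (_+_ to _+ℕ_)
open import Data.Nat.Combinatorics using (_C_)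
open import Data.Integer using (ℤ; +_) renaming (-_ to -ℤ_; _<?_ to _<ℤ?_)
open import Data.List using (List; []; _∷_; concatMap; map; upTo; foldr)
open import Relation.Nullary.Decidable using (⌊_⌋)
open import Algebra.Bundles using (CommutativeRing)

insertAll : {A : Set} → A → List A → List (List A)
insertAll a [] = (a ∷ []) ∷ []
insertAll a (b ∷ l) = (a ∷ b ∷ l) ∷ map (b ∷_) (insertAll a l)

perms : {A : Set} → List A → List (List A)
perms [] = [] ∷ []
perms (a ∷ l) = concatMap (insertAll a) (perms l)

signings : List ℕ → List (List ℤ)
signings [] = [] ∷ []
signings (a ∷ l) = concatMap (λ s → ((+ a) ∷ s) ∷ ((-ℤ (+ a)) ∷ s) ∷ []) (signings l)

-- the list of all elements of B_n (each exactly once), as words σ(1)…σ(n)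
signedPerms : ℕ → List (List ℤ)
signedPerms n = concatMap signings (perms (map suc (upTo n)))

-- Statistics, computed on the word 0 σ(1) … σ(n) (positions 0,1,…,n)

isEven : ℕ → Bool
isEven zero = true
isEven (suc n) = not (isEven n)

desOddFrom : ℕ → List ℤ → ℕ
desOddFrom i (a ∷ b ∷ rest) =
  (if not (isEven i) ∧ ⌊ b <ℤ? a ⌋ then 1 else 0) +ℕ desOddFrom (suc i) (b ∷ rest)
desOddFrom i _ = 0

ascEvenFrom : ℕ → List ℤ → ℕ
ascEvenFrom i (a ∷ b ∷ rest) =
  (if isEven i ∧ ⌊ a <ℤ? b ⌋ then 1 else 0) +ℕ ascEvenFrom (suc i) (b ∷ rest)
ascEvenFrom i _ = 0

des₁ : List ℤ → ℕ
des₁ σ = desOddFrom 0 (+ 0 ∷ σ)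

asc₀ : List ℤ → ℕ
asc₀ σ = ascEvenFrom 0 (+ 0 ∷ σ)

-- Generating functions, over an arbitrary commutative ring R with
-- x y ∈ R (equivalently: over ℤ[x,y], the universal case).
-- A formal power series Σ a_k t^k / k!  (exponential normalisation)
-- is represented by its coefficient sequence a : ℕ → R.

module _ {c ℓ : Level} (R : CommutativeRing c ℓ) where
  open CommutativeRing R

  pow : Carrier → ℕ → Carrier
  pow a zero = 1#
  pow a (suc n) = a * pow a n

  natR : ℕ → Carrier
  natR zero = 0#
  natR (suc n) = 1# + natR n

  sumR : List Carrier → Carrier
  sumR = foldr _+_ 0#

  sumTo : ℕ → (ℕ → Carrier) → Carrier
  sumTo N f = sumR (map f (upTo (suc N)))

  Bhat : Carrier → Carrier → ℕ → Carrier
  Bhat x y n = sumR (map (λ σ → pow x (des₁ σ) * pow y (asc₀ σ)) (signedPerms n))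

  -- product of exponential generating functions:
  -- (Σ a_k t^k/k!)(Σ b_k t^k/k!) has N-th coefficient Σ_k (N choose k) a_k b_{N-k}
  egfMul : (ℕ → Carrier) → (ℕ → Carrier) → ℕ → Carrier
  egfMul a b N = sumTo N (λ k → natR (N C k) * (a k * b (N ∸ k)))

  constS : Carrier → ℕ → Carrier
  constS a zero = a
  constS a (suc _) = 0#

  module _ (x y : Carrier) where
    α : Carrier
    α = (1# - x) * (1# - y)

    -- Σ_{n≥0} (-α)^n (2t)^{2n}/(2n)!   : coefficient of t^k/k!
    cosLike2 : ℕ → Carrier
    cosLike2 k = if isEven k then natR (2 ^ k) * pow (- α) ⌊ k /2⌋ else 0#

    -- Σ_{n≥0} (-α)^{n+1} t^{2n}/(2n)!
    cosLike1 : ℕ → Carrier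
    cosLike1 k = if isEven k then pow (- α) (suc ⌊ k /2⌋) else 0#

    -- Σ_{n≥0} (-α)^{n+1} t^{2n+1}/(2n+1)!
    sinLike1 : ℕ → Carrier
    sinLike1 k = if isEven k then 0# else pow (- α) (suc ⌊ k /2⌋)

    evenB : ℕ → Carrier
    evenB zero = 0#
    evenB (suc k) = if isEven (suc k) then Bhat x y (suc k) else 0#

    oddB : ℕ → Carrier
    oddB k = if isEven k then 0# else Bhat x y k

    denom : ℕ → Carrier
    denom k = constS (x + y) k - (1# + x * y) * cosLike2 k

    numEven : ℕ → Carrier
    numEven k = (1# + x * y) * cosLike2 k + cosLike1 k - constS (x + y) k

    numOdd : ℕ → Carrier
    numOdd k = (1# + y) * sinLike1 k

{-# OPTIONS --safe #-}

-- At an even position the weight of an adjacent pair is 1 + (y - 1)[ascent], at an odd position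
-- x + (1 - x)[ascent].  Expanding the product of all the weights and collecting the terms by the
-- last position where the ascent indicator is not chosen writes a signed permutation as a shorter
-- one followed by an increasing block.  Summing over signed arrangements is done by inserting the
-- letters ±a one after the other; insertion is a derivation for deconcatenation of words, so the
-- decomposition becomes a linear relation between exponential generating functions.  An increasing
-- block of length k contributes 2^k (1 if it is attached to the initial 0) times alternating factors
-- y - 1 and 1 - x, whose product is -α.  The even and odd parts of the relation form a 2 × 2 linear
-- system, with determinant the stated denominator divided by -α, which the subtraction
-- formulas for cosh and sinh solve.
module Submission where

open import Defs
open import Level using (Level)
open import Data.Nat using (ℕ)
open import Data.Product using (_×_)
open import Algebra.Bundles using (CommutativeRing)
open import Algebra.Solver.Ring.AlmostCommutativeRing using (fromCommutativeRing; _-Raw-AlmostCommutative⟶_)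
import Algebra.Solver.Ring as RingSolver
open import Data.Bool.Base using (Bool; true; false; if_then_else_; not; _∧_)
open import Data.Bool.Properties using (not-injective; not-involutive)
open import Data.Integer.Base as ℤ using (ℤ; +_; -[1+_]; +0; +[1+_]; ∣_∣)
import Data.Integer.Properties as ℤₚ
open import Data.List.Base using (List; []; _∷_; _++_; map; concatMap; length; upTo; applyUpTo)
open import Data.List.Properties using (map-++; length-map; length-upTo)
open import Data.List.Relation.Binary.Sublist.Propositional using (_⊆_; []; _∷_; _∷ʳ_)
open import Data.List.Relation.Binary.Sublist.Propositional.Properties using (All-resp-⊆; length-mono-≤)
open import Data.List.Relation.Unary.All as All using (All; []; _∷_)
import Data.List.Relation.Unary.All.Properties as Allₚ
open import Data.List.Relation.Unary.AllPairs using (AllPairs; []; _∷_)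
import Data.List.Relation.Unary.AllPairs.Properties as AllPairsₚ
open import Data.Maybe.Base as Maybe using (Maybe)
open import Data.Nat.Base as ℕ using (zero; suc; _∸_; _<_; z<s; s<s; s≤s⁻¹; ⌊_/2⌋; _^_)
open import Data.Nat.Combinatorics using (_C_; nCk+nC[k+1]≡[n+1]C[k+1]; k>n⇒nCk≡0)
open import Data.Nat.Induction using (<-rec)
import Data.Nat.Properties as ℕₚ
open import Data.Product.Base using (_,_; proj₁; proj₂)
open import Function.Base using (_∘_; id)
open import Relation.Binary.Consequences using (dec⇒weaklyDec)
open import Relation.Binary.Definitions using (tri<; tri≈; tri>)
open import Relation.Binary.PropositionalEquality as ≡ using (_≡_; _≢_)
open import Relation.Nullary using (¬_; yes; no; contradiction)
open import Relation.Nullary.Decidable using (⌊_⌋)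

-- A ring solver with integer coefficients over any commutative ring.

module IntegerSolver {c ℓ : Level} (R : CommutativeRing c ℓ) where
  open CommutativeRing R
  open import Algebra.Properties.Ring ring
  open import Algebra.Properties.AbelianGroup +-abelianGroup using (⁻¹-∙-comm; ε⁻¹≈ε; ⁻¹-involutive)
  open import Algebra.Properties.Semiring.Mult.TCOptimised semiring renaming (_×_ to _·_)
  open import Relation.Binary.Reasoning.Setoid setoid

  -- With the optimised multiple, `1 · 1#` reduces to `1#` and `2 · 1#` to `1# + 1#`, so constants
  -- in solver expressions match ring terms definitionally.
  fromℤ : ℤ → Carrier
  fromℤ (+ n)    = n · 1#
  fromℤ -[1+ n ] = - (suc n · 1#)

  fromℤ-neg : ∀ i → fromℤ (ℤ.- i) ≈ - fromℤ i
  fromℤ-neg -[1+ n ] = sym (⁻¹-involutive _)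
  fromℤ-neg +0       = sym ε⁻¹≈ε
  fromℤ-neg +[1+ n ] = refl

  private
    x+y-[x+z] : ∀ x y z → (x + y) - (x + z) ≈ y - z
    x+y-[x+z] x y z = begin
      (x + y) - (x + z)         ≈⟨ +-cong (+-comm x y) (sym (⁻¹-∙-comm x z)) ⟩
      (y + x) + (- x + - z)     ≈⟨ +-assoc y x _ ⟩
      y + (x + (- x + - z))     ≈⟨ +-congˡ (+-assoc x (- x) (- z)) ⟨
      y + ((x - x) - z)         ≈⟨ +-congˡ (+-congʳ (-‿inverseʳ x)) ⟩
      y + (0# - z)              ≈⟨ +-congˡ (+-identityˡ _) ⟩
      y - z                     ∎

  fromℤ-⊖ : ∀ m n → fromℤ (m ℤ.⊖ n) ≈ m · 1# - n · 1#
  fromℤ-⊖ zero    zero    = sym (-‿inverseʳ 0#)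
  fromℤ-⊖ zero    (suc n) = sym (+-identityˡ _)
  fromℤ-⊖ (suc m) zero    = sym (trans (+-congˡ ε⁻¹≈ε) (+-identityʳ _))
  fromℤ-⊖ (suc m) (suc n) = begin
    fromℤ (suc m ℤ.⊖ suc n)              ≡⟨ ≡.cong fromℤ (ℤₚ.[1+m]⊖[1+n]≡m⊖n m n) ⟩
    fromℤ (m ℤ.⊖ n)                      ≈⟨ fromℤ-⊖ m n ⟩
    m · 1# - n · 1#                      ≈⟨ x+y-[x+z] 1# _ _ ⟨
    (1# + m · 1#) - (1# + n · 1#)        ≈⟨ +-cong (1+× m 1#) (-‿cong (1+× n 1#)) ⟨
    suc m · 1# - suc n · 1#              ∎

  fromℤ-+ : ∀ i j → fromℤ (i ℤ.+ j) ≈ fromℤ i + fromℤ j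
  fromℤ-+ -[1+ m ] -[1+ n ] = begin
    - (suc (suc (m ℕ.+ n)) · 1#)     ≡⟨ ≡.cong (λ k → - (k · 1#)) (ℕₚ.+-suc (suc m) n) ⟨
    - ((suc m ℕ.+ suc n) · 1#)       ≈⟨ -‿cong (×-homo-+ 1# (suc m) (suc n)) ⟩
    - (suc m · 1# + suc n · 1#)      ≈⟨ ⁻¹-∙-comm _ _ ⟨
    - (suc m · 1#) - (suc n · 1#)    ∎
  fromℤ-+ -[1+ m ] (+ n)    = trans (fromℤ-⊖ n (suc m)) (+-comm _ _)
  fromℤ-+ (+ m)    -[1+ n ] = fromℤ-⊖ m (suc n)
  fromℤ-+ (+ m)    (+ n)    = ×-homo-+ 1# m n

  private
    fromℤ-pos* : ∀ m n → fromℤ (+ m ℤ.* + n) ≈ fromℤ (+ m) * fromℤ (+ n)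
    fromℤ-pos* m n = begin
      fromℤ (+ m ℤ.* + n)           ≡⟨ ≡.cong fromℤ (ℤₚ.pos-* m n) ⟨
      (m ℕ.* n) · 1#                ≈⟨ ×1-homo-* m n ⟩
      (m · 1#) * (n · 1#)           ∎

    fromℤ-neg* : ∀ i j → fromℤ (i ℤ.* j) ≈ fromℤ i * fromℤ j →
                 fromℤ (ℤ.- i ℤ.* j) ≈ - fromℤ i * fromℤ j
    fromℤ-neg* i j eq = begin
      fromℤ (ℤ.- i ℤ.* j)       ≡⟨ ≡.cong fromℤ (ℤₚ.neg-distribˡ-* i j) ⟨
      fromℤ (ℤ.- (i ℤ.* j))     ≈⟨ fromℤ-neg (i ℤ.* j) ⟩
      - fromℤ (i ℤ.* j)         ≈⟨ -‿cong eq ⟩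
      - (fromℤ i * fromℤ j)     ≈⟨ -‿distribˡ-* _ _ ⟩
      - fromℤ i * fromℤ j       ∎

    fromℤ-*neg : ∀ i j → fromℤ (i ℤ.* j) ≈ fromℤ i * fromℤ j →
                 fromℤ (i ℤ.* ℤ.- j) ≈ fromℤ i * - fromℤ j
    fromℤ-*neg i j eq = begin
      fromℤ (i ℤ.* ℤ.- j)       ≡⟨ ≡.cong fromℤ (ℤₚ.neg-distribʳ-* i j) ⟨
      fromℤ (ℤ.- (i ℤ.* j))     ≈⟨ fromℤ-neg (i ℤ.* j) ⟩
      - fromℤ (i ℤ.* j)         ≈⟨ -‿cong eq ⟩
      - (fromℤ i * fromℤ j)     ≈⟨ -‿distribʳ-* _ _ ⟩
      fromℤ i * - fromℤ j       ∎

  fromℤ-* : ∀ i j → fromℤ (i ℤ.* j) ≈ fromℤ i * fromℤ j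
  fromℤ-* (+ m)    (+ n)    = fromℤ-pos* m n
  fromℤ-* (+ m)    -[1+ n ] = fromℤ-*neg (+ m) (+ suc n) (fromℤ-pos* m (suc n))
  fromℤ-* -[1+ m ] (+ n)    = fromℤ-neg* (+ suc m) (+ n) (fromℤ-pos* (suc m) n)
  fromℤ-* -[1+ m ] -[1+ n ] =
    fromℤ-neg* (+ suc m) -[1+ n ] (fromℤ-*neg (+ suc m) (+ suc n) (fromℤ-pos* (suc m) (suc n)))

  morphism : ℤ.+-*-rawRing -Raw-AlmostCommutative⟶ fromCommutativeRing R
  morphism = record
    { ⟦_⟧ = fromℤ ; +-homo = fromℤ-+ ; *-homo = fromℤ-* ; -‿homo = fromℤ-neg
    ; 0-homo = refl ; 1-homo = refl }

  -- Equality in `R` need not be decidable, so the solver compares coefficients as integers.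
  fromℤ-weaklyDec : ∀ i j → Maybe (fromℤ i ≈ fromℤ j)
  fromℤ-weaklyDec i j = Maybe.map (λ i≡j → reflexive (≡.cong fromℤ i≡j)) (dec⇒weaklyDec ℤₚ._≟_ i j)

  open RingSolver ℤ.+-*-rawRing (fromCommutativeRing R) morphism fromℤ-weaklyDec public
    using (solve; con; _:=_; _:+_; _:*_; _:-_; :-_)

-- Solution of the 2 × 2 linear system.

module Elimination {c ℓ : Level} (S : CommutativeRing c ℓ) where
  open CommutativeRing S
  open IntegerSolver S
  open import Algebra.Properties.Group +-group using (x∙y⁻¹≈ε⇒x≈y; x≈y⇒x∙y⁻¹≈ε)

  private
    -- The eliminations below are certified as linear combinations of the hypotheses: the difference
    -- of the two sides of each hypothesis is 0, hence so is any multiple, and the sum of the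
    -- multiples.
    *0 : ∀ {a b d} → a ≈ b → d * (a - b) ≈ 0#
    *0 {a} {b} {d} a≈b = trans (*-congˡ (x≈y⇒x∙y⁻¹≈ε a≈b)) (zeroʳ d)

    infixr 5 _⊹_
    _⊹_ : ∀ {a b} → a ≈ 0# → b ≈ 0# → a + b ≈ 0#
    a≈0 ⊹ b≈0 = trans (+-cong a≈0 b≈0) (+-identityˡ 0#)

  -- Sorts the summands by parity when `o`, `b` and `s` are odd series and the other variables even
  -- ones.
  collect : ∀ e o a b q s x u v →
    (a + b) + (e * (v * q + s) + o * (x * u * q + x * s)) ≈
    (a + (e * (v * q) + o * (x * s))) + (b + (e * s + o * (x * u * q)))
  collect = solve 9 (λ e o a b q s x u v →
    (a :+ b) :+ (e :* (v :* q :+ s) :+ o :* (x :* u :* q :+ x :* s)) :=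
    (a :+ (e :* (v :* q) :+ o :* (x :* s))) :+ (b :+ (e :* s :+ o :* (x :* u :* q)))) refl

  pred-* : ∀ a b → (a - 1#) * b ≈ a * b - b
  pred-* = solve 2 (λ a b → (a :- con (+ 1)) :* b := a :* b :- b) refl

  -- With β = (Y - 1)(1 - X), `C₁` and `S₁` stand for the hyperbolic cosine and sine of √β t, `c`
  -- and `s` for those of 2√β t, both sines being divided by √β. The remaining unknown `q` plays the
  -- part of (c - 1)/β, and `h₃` says so without dividing.
  module LinearSystem {X Y fₑ fₒ C₁ S₁ c s q : Carrier}
    (h₁ : fₑ ≈ C₁ + (fₑ * ((1# - X) * q) + fₒ * (X * s)))
    (h₂ : fₒ ≈ (Y - 1#) * S₁ + (fₑ * s + fₒ * (X * (Y - 1#) * q)))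
    (h₃ : (Y - 1#) * (1# - X) * q ≈ c - 1#)
    (h₄ : c * c - (Y - 1#) * (1# - X) * (s * s) ≈ 1#)
    (h₅ : C₁ * c - (Y - 1#) * (1# - X) * (S₁ * s) ≈ C₁)
    (h₆ : C₁ * s - S₁ * c ≈ S₁)
    where

    -- The coefficients of the first two hypotheses are those of Cramer's rule; the others reduce the
    -- determinant and the numerators.
    even-part : fₑ * (X + Y - (1# + X * Y) * c) ≈ (Y - 1#) * (1# - X) * C₁
    even-part = x∙y⁻¹≈ε⇒x≈y _ _ (trans
      (solve 9 (λ X Y fₑ fₒ C₁ S₁ c s q → let 1′ = con (+ 1); u = Y :- 1′; v = 1′ :- X; β = u :* v in
        (fₑ :* (X :+ Y :- (1′ :+ X :* Y) :* c) :- β :* C₁) :=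
          (β :* (1′ :- X :* u :* q) :* (fₑ :- (C₁ :+ (fₑ :* (v :* q) :+ fₒ :* (X :* s))))
        :+ (β :* X :* s :* (fₒ :- (u :* S₁ :+ (fₑ :* s :+ fₒ :* (X :* u :* q))))
        :+ ((fₑ :* ((v :+ X :* u) :- X :* (β :* q :+ (c :- 1′))) :- X :* u :* C₁) :* (β :* q :- (c :- 1′))
        :+ ((:- (X :* fₑ)) :* ((c :* c :- β :* (s :* s)) :- 1′)
        :+ ((:- (X :* u)) :* ((C₁ :* c :- β :* (S₁ :* s)) :- C₁)))))))
        refl X Y fₑ fₒ C₁ S₁ c s q)
      (*0 h₁ ⊹ *0 h₂ ⊹ *0 h₃ ⊹ *0 h₄ ⊹ *0 h₅))

    odd-part : fₒ * (X + Y - (1# + X * Y) * c) ≈ (1# + Y) * ((Y - 1#) * (1# - X) * S₁)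
    odd-part = x∙y⁻¹≈ε⇒x≈y _ _ (trans
      (solve 9 (λ X Y fₑ fₒ C₁ S₁ c s q → let 1′ = con (+ 1); u = Y :- 1′; v = 1′ :- X; β = u :* v in
        (fₒ :* (X :+ Y :- (1′ :+ X :* Y) :* c) :- (1′ :+ Y) :* (β :* S₁)) :=
          (β :* s :* (fₑ :- (C₁ :+ (fₑ :* (v :* q) :+ fₒ :* (X :* s))))
        :+ (β :* (1′ :- v :* q) :* (fₒ :- (u :* S₁ :+ (fₑ :* s :+ fₒ :* (X :* u :* q))))
        :+ ((fₒ :* ((v :+ X :* u) :- X :* (β :* q :+ (c :- 1′))) :- β :* S₁) :* (β :* q :- (c :- 1′))
        :+ ((:- (X :* fₒ)) :* ((c :* c :- β :* (s :* s)) :- 1′)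
        :+ (β :* ((C₁ :* s :- S₁ :* c) :- S₁)))))))
        refl X Y fₑ fₒ C₁ S₁ c s q)
      (*0 h₁ ⊹ *0 h₂ ⊹ *0 h₃ ⊹ *0 h₄ ⊹ *0 h₆))

-- The commutative ring of exponential generating functions.

module Series {r ℓ : Level} (R : CommutativeRing r ℓ) where
  open CommutativeRing R
  open import Relation.Binary.Reasoning.Setoid setoid
  open import Algebra.Properties.CommutativeSemigroup +-commutativeSemigroup using (interchange)
  private module RS = IntegerSolver R

  Seq : Set r
  Seq = ℕ → Carrier

  infix 4 _≋_
  _≋_ : Seq → Seq → Set ℓ
  a ≋ b = ∀ k → a k ≈ b k

  D : Seq → Seq
  D a k = a (suc k)

  ι : Carrier → Seq
  ι = constS R

  infixl 7 _⊛_
  -- In the exponential normalisation the shift `D` is the derivative. Defining the product by the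
  -- Leibniz rule avoids binomial coefficients and makes the ring laws short inductions.
  _⊛_ : Seq → Seq → Seq
  (a ⊛ b) zero    = a 0 * b 0
  (a ⊛ b) (suc n) = (D a ⊛ b) n + (a ⊛ D b) n

  ⊛-cong : ∀ {a a′ b b′} → a ≋ a′ → b ≋ b′ → a ⊛ b ≋ a′ ⊛ b′
  ⊛-cong p q zero    = *-cong (p 0) (q 0)
  ⊛-cong p q (suc n) = +-cong (⊛-cong (p ∘ suc) q n) (⊛-cong p (q ∘ suc) n)

  ⊛-comm : ∀ a b → a ⊛ b ≋ b ⊛ a
  ⊛-comm a b zero    = *-comm _ _
  ⊛-comm a b (suc n) = trans (+-cong (⊛-comm (D a) b n) (⊛-comm a (D b) n)) (+-comm _ _)

  ⊛-distribˡ : ∀ a b d → a ⊛ (λ k → b k + d k) ≋ (λ k → (a ⊛ b) k + (a ⊛ d) k)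
  ⊛-distribˡ a b d zero    = distribˡ _ _ _
  ⊛-distribˡ a b d (suc n) =
    trans (+-cong (⊛-distribˡ (D a) b d n) (⊛-distribˡ a (D b) (D d) n)) (interchange _ _ _ _)

  ⊛-distribʳ : ∀ a b d → (λ k → b k + d k) ⊛ a ≋ (λ k → (b ⊛ a) k + (d ⊛ a) k)
  ⊛-distribʳ a b d k =
    trans (⊛-comm _ a k) (trans (⊛-distribˡ a b d k) (+-cong (⊛-comm a b k) (⊛-comm a d k)))

  ⊛-assoc : ∀ a b d → (a ⊛ b) ⊛ d ≋ a ⊛ (b ⊛ d)
  ⊛-assoc a b d zero    = *-assoc _ _ _
  ⊛-assoc a b d (suc n) = begin
    (D (a ⊛ b) ⊛ d) n + ((a ⊛ b) ⊛ D d) n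
      ≈⟨ +-congʳ (⊛-distribʳ d (D a ⊛ b) (a ⊛ D b) n) ⟩
    (((D a ⊛ b) ⊛ d) n + ((a ⊛ D b) ⊛ d) n) + ((a ⊛ b) ⊛ D d) n
      ≈⟨ +-cong (+-cong (⊛-assoc (D a) b d n) (⊛-assoc a (D b) d n)) (⊛-assoc a b (D d) n) ⟩
    ((D a ⊛ (b ⊛ d)) n + (a ⊛ (D b ⊛ d)) n) + (a ⊛ (b ⊛ D d)) n
      ≈⟨ +-assoc _ _ _ ⟩
    (D a ⊛ (b ⊛ d)) n + ((a ⊛ (D b ⊛ d)) n + (a ⊛ (b ⊛ D d)) n)
      ≈⟨ +-congˡ (⊛-distribˡ a (D b ⊛ d) (b ⊛ D d) n) ⟨
    (D a ⊛ (b ⊛ d)) n + (a ⊛ D (b ⊛ d)) n ∎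

  ⊛-zeroˡ : ∀ a → (λ _ → 0#) ⊛ a ≋ (λ _ → 0#)
  ⊛-zeroˡ a zero    = zeroˡ _
  ⊛-zeroˡ a (suc n) = trans (+-cong (⊛-zeroˡ a n) (⊛-zeroˡ (D a) n)) (+-identityˡ 0#)

  ι-⊛ : ∀ z a → ι z ⊛ a ≋ (λ k → z * a k)
  ι-⊛ z a zero    = refl
  ι-⊛ z a (suc n) = trans (+-cong (⊛-zeroˡ a n) (ι-⊛ z (D a) n)) (+-identityˡ _)

  ⊛-identityˡ : ∀ a → ι 1# ⊛ a ≋ a
  ⊛-identityˡ a k = trans (ι-⊛ 1# a k) (*-identityˡ _)

  seriesRing : CommutativeRing r ℓ
  seriesRing = record
    { Carrier = Seq
    ; _≈_     = _≋_
    ; _+_     = λ a b k → a k + b k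
    ; _*_     = _⊛_
    ; -_      = λ a k → - a k
    ; 0#      = λ _ → 0#
    ; 1#      = ι 1#
    ; isCommutativeRing = record
      { isRing = record
        { +-isAbelianGroup = record
          { isGroup = record
            { isMonoid = record
              { isSemigroup = record
                { isMagma = record
                  { isEquivalence = record
                    { refl  = λ _ → refl
                    ; sym   = λ p k → sym (p k)
                    ; trans = λ p q k → trans (p k) (q k)
                    }
                  ; ∙-cong = λ p q k → +-cong (p k) (q k)
                  }
                ; assoc = λ _ _ _ _ → +-assoc _ _ _
                }
              ; identity = (λ _ _ → +-identityˡ _) , (λ _ _ → +-identityʳ _)
              }
            ; inverse = (λ _ _ → -‿inverseˡ _) , (λ _ _ → -‿inverseʳ _)
            ; ⁻¹-cong = λ p k → -‿cong (p k)
            }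
          ; comm = λ _ _ _ → +-comm _ _
          }
        ; *-cong     = ⊛-cong
        ; *-assoc    = ⊛-assoc
        ; *-identity = ⊛-identityˡ , (λ a k → trans (⊛-comm a (ι 1#) k) (⊛-identityˡ a k))
        ; distrib    = ⊛-distribˡ , ⊛-distribʳ
        }
      ; *-comm = ⊛-comm
      }
    }

  private
    Σ< : ℕ → Seq → Carrier
    Σ< zero    f = 0#
    Σ< (suc n) f = f 0 + Σ< n (f ∘ suc)

    sumR-applyUpTo : ∀ (f : Seq) (g : ℕ → ℕ) n → sumR R (map f (applyUpTo g n)) ≈ Σ< n (f ∘ g)
    sumR-applyUpTo f g zero    = refl
    sumR-applyUpTo f g (suc n) = +-congˡ (sumR-applyUpTo f (g ∘ suc) n)

    Σ<-cong : ∀ n {f g} → (∀ k → k < n → f k ≈ g k) → Σ< n f ≈ Σ< n g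
    Σ<-cong zero    p = refl
    Σ<-cong (suc n) p = +-cong (p 0 z<s) (Σ<-cong n (λ k k<n → p (suc k) (s<s k<n)))

    Σ<-+ : ∀ n f g → Σ< n (λ k → f k + g k) ≈ Σ< n f + Σ< n g
    Σ<-+ zero    f g = sym (+-identityˡ 0#)
    Σ<-+ (suc n) f g = trans (+-congˡ (Σ<-+ n (f ∘ suc) (g ∘ suc))) (interchange _ _ _ _)

    Σ<-last : ∀ n f → Σ< (suc n) f ≈ Σ< n f + f n
    Σ<-last zero    f = +-comm _ _
    Σ<-last (suc n) f = trans (+-congˡ (Σ<-last n (f ∘ suc))) (sym (+-assoc _ _ _))

  natR-+ : ∀ m n → natR R (m ℕ.+ n) ≈ natR R m + natR R n
  natR-+ zero    n = sym (+-identityˡ _)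
  natR-+ (suc m) n = trans (+-congˡ (natR-+ m n)) (sym (+-assoc _ _ _))

  egfMul-Σ< : ∀ a b n → egfMul R a b n ≈ Σ< (suc n) (λ k → natR R (n C k) * (a k * b (n ∸ k)))
  egfMul-Σ< a b n = sumR-applyUpTo (λ k → natR R (n C k) * (a k * b (n ∸ k))) id (suc n)

  -- Pascal's rule splits each binomial coefficient into the contributions of the two derivatives.
  egfMul-leibniz : ∀ a b n → egfMul R a b (suc n) ≈ egfMul R (D a) b n + egfMul R a (D b) n
  egfMul-leibniz a b n = begin
    egfMul R a b (suc n)
      ≈⟨ egfMul-Σ< a b (suc n) ⟩
    t (suc n) 0 + Σ< (suc n) (t (suc n) ∘ suc)
      ≈⟨ +-congˡ (trans (Σ<-cong (suc n) (λ k _ → pascal k)) (Σ<-+ (suc n) l (t n ∘ suc))) ⟩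
    t n 0 + (Σ< (suc n) l + Σ< (suc n) (t n ∘ suc))
      ≈⟨ RS.solve 3 (λ x y z → (x RS.:+ (y RS.:+ z)) RS.:= (y RS.:+ (x RS.:+ z))) refl _ _ _ ⟩
    Σ< (suc n) l + Σ< (suc (suc n)) (t n)
      ≈⟨ +-congˡ (Σ<-last (suc n) (t n)) ⟩
    Σ< (suc n) l + (Σ< (suc n) (t n) + t n (suc n))
      -- The term k = n + 1 that completed the range carries the coefficient n C (n + 1) = 0.
      ≈⟨ +-congˡ (trans (+-congˡ last-vanishes) (+-identityʳ _)) ⟩
    Σ< (suc n) l + Σ< (suc n) (t n)
      ≈⟨ +-cong (egfMul-Σ< (D a) b n) (trans (egfMul-Σ< a (D b) n) (Σ<-cong (suc n) shift)) ⟨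
    egfMul R (D a) b n + egfMul R a (D b) n ∎
    where
    t : ℕ → Seq
    t m k = natR R (m C k) * (a k * b (suc n ∸ k))

    l : Seq
    l k = natR R (n C k) * (a (suc k) * b (n ∸ k))

    pascal : ∀ k → t (suc n) (suc k) ≈ l k + t n (suc k)
    pascal k = begin
      natR R (suc n C suc k) * (a (suc k) * b (n ∸ k))
        ≡⟨ ≡.cong (λ m → natR R m * (a (suc k) * b (n ∸ k))) (nCk+nC[k+1]≡[n+1]C[k+1] n k) ⟨
      natR R (n C k ℕ.+ n C suc k) * (a (suc k) * b (n ∸ k))
        ≈⟨ *-congʳ (natR-+ (n C k) (n C suc k)) ⟩
      (natR R (n C k) + natR R (n C suc k)) * (a (suc k) * b (n ∸ k))
        ≈⟨ distribʳ _ _ _ ⟩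
      l k + t n (suc k) ∎

    last-vanishes : t n (suc n) ≈ 0#
    last-vanishes =
      trans (*-congʳ (reflexive (≡.cong (natR R) (k>n⇒nCk≡0 (ℕₚ.n<1+n n))))) (zeroˡ _)

    shift : ∀ k → k < suc n → natR R (n C k) * (a k * b (suc (n ∸ k))) ≈ t n k
    shift k k<1+n =
      reflexive (≡.cong (λ m → natR R (n C k) * (a k * b m)) (≡.sym (ℕₚ.+-∸-assoc 1 (s≤s⁻¹ k<1+n))))

  -- Both products have the same constant term and obey the same Leibniz recursion.
  egfMul≋⊛ : ∀ a b → egfMul R a b ≋ a ⊛ b
  egfMul≋⊛ a b zero    = RS.solve 1 (λ x → ((RS.con (+ 1) RS.:+ RS.con (+ 0)) RS.:* x RS.:+ RS.con (+ 0)) RS.:= x) refl _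
  egfMul≋⊛ a b (suc n) =
    trans (egfMul-leibniz a b n) (+-cong (egfMul≋⊛ (D a) b n) (egfMul≋⊛ a (D b) n))

  -- Even and odd series.

  HasParity : Bool → Seq → Set ℓ
  HasParity p a = ∀ k → isEven k ≡ not p → a k ≈ 0#

  D-parity : ∀ {p a} → HasParity p a → HasParity (not p) (D a)
  D-parity {p} par k eq = par (suc k) (≡.trans (≡.cong not eq) (not-involutive (not p)))

  private
    same : Bool → Bool → Bool
    same true  q = q
    same false q = not q

    same-notˡ : ∀ p q → same (not p) q ≡ not (same p q)
    same-notˡ true  q = ≡.refl
    same-notˡ false q = ≡.sym (not-involutive q)

    same-notʳ : ∀ p q → same p (not q) ≡ not (same p q)
    same-notʳ true  q = ≡.refl
    same-notʳ false q = ≡.refl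

    -- Differentiating one factor flips its parity and that of the product, so the induction runs
    -- over all pairs of parities at once.
    ⊛-parity-same : ∀ p q {a b} → HasParity p a → HasParity q b → HasParity (same p q) (a ⊛ b)
    ⊛-parity-same true  false α β zero    eq = trans (*-congˡ (β 0 ≡.refl)) (zeroʳ _)
    ⊛-parity-same false true  α β zero    eq = trans (*-congʳ (α 0 ≡.refl)) (zeroˡ _)
    ⊛-parity-same p q α β (suc k) eq = trans (+-cong
      (⊛-parity-same (not p) q (D-parity α) β k (≡.trans eq′ (≡.cong not (≡.sym (same-notˡ p q)))))
      (⊛-parity-same p (not q) α (D-parity β) k (≡.trans eq′ (≡.cong not (≡.sym (same-notʳ p q))))))
      (+-identityˡ 0#)
      where
      eq′ : isEven k ≡ not (not (same p q))
      eq′ = ≡.trans (not-injective eq) (≡.sym (not-involutive _))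

  even⊛ : ∀ {p a b} → HasParity true a → HasParity p b → HasParity p (a ⊛ b)
  even⊛ {p} = ⊛-parity-same true p

  odd⊛ : ∀ {p a b} → HasParity false a → HasParity p b → HasParity (not p) (a ⊛ b)
  odd⊛ {p} = ⊛-parity-same false p

  ι-even : ∀ z → HasParity true (ι z)
  ι-even z (suc k) eq = refl

  +-parity : ∀ {p a b} → HasParity p a → HasParity p b → HasParity p (λ k → a k + b k)
  +-parity α β k eq = trans (+-cong (α k eq) (β k eq)) (+-identityˡ 0#)

  -- At each index one summand on either side vanishes, so an equation of sums compares the
  -- surviving summands.
  parity-split : ∀ {a a′ b b′} → HasParity true a → HasParity true a′ →
                 HasParity false b → HasParity false b′ →
                 (λ k → a k + b k) ≋ (λ k → a′ k + b′ k) → (a ≋ a′) × (b ≋ b′)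
  parity-split {a} {a′} {b} {b′} α α′ β β′ eq = ev , od
    where
    ev : a ≋ a′
    ev k with isEven k in e
    ... | true  = begin
      a k         ≈⟨ +-identityʳ _ ⟨
      a k + 0#    ≈⟨ +-congˡ (β k e) ⟨
      a k + b k   ≈⟨ eq k ⟩
      a′ k + b′ k ≈⟨ +-congˡ (β′ k e) ⟩
      a′ k + 0#   ≈⟨ +-identityʳ _ ⟩
      a′ k        ∎
    ... | false = trans (α k e) (sym (α′ k e))

    od : b ≋ b′
    od k with isEven k in e
    ... | true  = trans (β k e) (sym (β′ k e))
    ... | false = begin
      b k         ≈⟨ +-identityˡ _ ⟨
      0# + b k    ≈⟨ +-congʳ (α k e) ⟨
      a k + b k   ≈⟨ eq k ⟩
      a′ k + b′ k ≈⟨ +-congʳ (α′ k e) ⟩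
      0# + b′ k   ≈⟨ +-identityˡ _ ⟩
      b′ k        ∎

-- Hyperbolic functions as formal series.

module Hyperbolic {r ℓ : Level} (R : CommutativeRing r ℓ) where
  open CommutativeRing R
  open Series R
  open IntegerSolver seriesRing
  private
    module S = CommutativeRing seriesRing
    module RS = IntegerSolver R

  2# : Carrier
  2# = 1# + 1#

  module _ (β : Carrier) where
    -- cosh (√β t) and sinh (√β t) / √β, so that no square root is needed
    cosh sinh : Seq
    cosh zero    = 1#
    cosh (suc k) = β * sinh k
    sinh zero    = 0#
    sinh (suc k) = cosh k

    -- The factor 2^k at index k substitutes 2t for t.
    cosh₂ sinh₂ : Seq
    cosh₂ k = pow R 2# k * cosh k
    sinh₂ k = pow R 2# k * sinh k

    -- (cosh (2√β t) - 1) / β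
    versinh₂ : Seq
    versinh₂ zero    = 0#
    versinh₂ (suc k) = pow R 2# (suc k) * sinh k

    β-versinh₂ : ι β ⊛ versinh₂ ≋ cosh₂ S.- S.1#
    β-versinh₂ zero    = RS.solve 1 (λ b → (b RS.:* RS.con (+ 0)) RS.:= (RS.con (+ 1) RS.:* RS.con (+ 1) RS.:- RS.con (+ 1))) refl β
    β-versinh₂ (suc k) = trans (ι-⊛ β versinh₂ (suc k))
      (RS.solve 3 (λ b p h → (b RS.:* (p RS.:* h)) RS.:= (p RS.:* (b RS.:* h) RS.:- RS.con (+ 0))) refl β _ _)

    cosh-even : HasParity true cosh
    sinh-odd  : HasParity false sinh
    cosh-even (suc k) eq = trans (*-congˡ (sinh-odd k (not-injective eq))) (zeroʳ β)
    sinh-odd zero    eq = refl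
    sinh-odd (suc k) eq = cosh-even k (not-injective eq)

    sinh₂-odd : HasParity false sinh₂
    sinh₂-odd k eq = trans (*-congˡ (sinh-odd k eq)) (zeroʳ _)

    versinh₂-even : HasParity true versinh₂
    versinh₂-even (suc k) eq = trans (*-congˡ (sinh-odd k (not-injective eq))) (zeroʳ _)

    cosh-pow : ∀ k → cosh k ≈ (if isEven k then pow R β ⌊ k /2⌋ else 0#)
    sinh-pow : ∀ k → sinh k ≈ (if isEven k then 0# else pow R β ⌊ k /2⌋)
    cosh-pow zero = refl
    cosh-pow (suc zero) = zeroʳ β
    cosh-pow (suc (suc k)) rewrite not-involutive (isEven k) with isEven k | cosh-pow k
    ... | true  | eq = *-congˡ eq
    ... | false | eq = trans (*-congˡ eq) (zeroʳ β)
    sinh-pow zero = refl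
    sinh-pow (suc zero) = refl
    sinh-pow (suc (suc k)) rewrite not-involutive (isEven k) with isEven k | sinh-pow k
    ... | true  | eq = trans (*-congˡ eq) (zeroʳ β)
    ... | false | eq = *-congˡ eq

    private
      D-ι⊛ : ∀ z a → D (ι z ⊛ a) ≋ ι z ⊛ D a
      D-ι⊛ z a k = trans (+-congʳ (⊛-zeroˡ a k)) (+-identityˡ _)

      D-cosh : D cosh ≋ ι β ⊛ sinh
      D-cosh k = sym (ι-⊛ β sinh k)

      D-cosh₂ : D cosh₂ ≋ ι 2# ⊛ (ι β ⊛ sinh₂)
      D-cosh₂ k = trans
        (RS.solve 4 (λ b p h t → (t RS.:* p RS.:* (b RS.:* h)) RS.:= (t RS.:* (b RS.:* (p RS.:* h)))) refl β _ _ _)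
        (sym (trans (ι-⊛ 2# _ k) (*-congˡ (ι-⊛ β sinh₂ k))))

      D-sinh₂ : D sinh₂ ≋ ι 2# ⊛ cosh₂
      D-sinh₂ k = trans (*-assoc 2# _ _) (sym (ι-⊛ 2# cosh₂ k))

      ι2 : ι 2# ≋ S.1# S.+ S.1#
      ι2 zero    = refl
      ι2 (suc k) = sym (+-identityˡ 0#)

      -- The initial values and the differential system P' = βQ, Q' = P determine all coefficients
      -- recursively.
      coshsinh-unique : ∀ {P Q} → P 0 ≈ 1# → Q 0 ≈ 0# → D P ≋ ι β ⊛ Q → D Q ≋ P →
                        (P ≋ cosh) × (Q ≋ sinh)
      coshsinh-unique {P} {Q} P0 Q0 DP DQ = P≋ , Q≋
        where
        P≋ : P ≋ cosh
        Q≋ : Q ≋ sinh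
        P≋ zero    = P0
        P≋ (suc k) = trans (DP k) (trans (ι-⊛ β Q k) (*-congˡ (Q≋ k)))
        Q≋ zero    = Q0
        Q≋ (suc k) = trans (DQ k) (P≋ k)

    -- The derivative of the left side vanishes and its constant coefficient is 1.
    cosh₂²-sinh₂² : cosh₂ ⊛ cosh₂ S.- ι β ⊛ (sinh₂ ⊛ sinh₂) ≋ S.1#
    cosh₂²-sinh₂² zero    = RS.solve 1 (λ b → let 1′ = RS.con (+ 1); 0′ = RS.con (+ 0) in
      ((1′ RS.:* 1′) RS.:* (1′ RS.:* 1′) RS.:- b RS.:* ((1′ RS.:* 0′) RS.:* (1′ RS.:* 0′))) RS.:= 1′) refl β
    cosh₂²-sinh₂² (suc k) = D-vanishes k
      where
      D-vanishes : D (cosh₂ ⊛ cosh₂ S.- ι β ⊛ (sinh₂ ⊛ sinh₂)) ≋ S.0#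
      D-vanishes = S.trans
        (S.+-cong (S.+-cong (S.*-congʳ D-cosh₂) (S.*-congˡ D-cosh₂))
          (S.-‿cong (S.trans (D-ι⊛ β _) (S.*-congˡ (S.+-cong (S.*-congʳ D-sinh₂) (S.*-congˡ D-sinh₂))))))
        (solve 4 (λ t b h c →
          (t :* (b :* h) :* c :+ c :* (t :* (b :* h)) :- b :* (t :* c :* h :+ h :* (t :* c))) := con (+ 0))
          S.refl (ι 2#) (ι β) sinh₂ cosh₂)

    private
      -- The subtraction-formula expressions for the hyperbolic cosine and sine at 2t - t. They are
      -- identified with `cosh` and `sinh` by solving the same differential system.
      P Q : Seq
      P = cosh ⊛ cosh₂ S.- ι β ⊛ (sinh ⊛ sinh₂)
      Q = cosh ⊛ sinh₂ S.- sinh ⊛ cosh₂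

      DP : D P ≋ ι β ⊛ Q
      DP = S.trans
        (S.+-cong (S.+-cong (S.*-congʳ D-cosh) (S.*-congˡ D-cosh₂))
          (S.-‿cong (S.trans (D-ι⊛ β _) (S.*-congˡ (S.+-congˡ {cosh ⊛ sinh₂} (S.*-congˡ D-sinh₂))))))
        -- The cancellation leaves 2 - 1 = 1 copies, so the value of 2 matters here: the constant
        -- series becomes a sum of two units, a numeral for the solver.
        (S.trans (S.+-cong (S.+-congˡ (S.*-congˡ (S.*-congʳ ι2)))
            (S.-‿cong (S.*-congˡ (S.+-congˡ {cosh ⊛ sinh₂} (S.*-congˡ (S.*-congʳ ι2))))))
        (solve 5 (λ b h c h₂ c₂ → let t = con (+ 2) in
          (b :* h :* c₂ :+ c :* (t :* (b :* h₂)) :- b :* (c :* h₂ :+ h :* (t :* c₂)))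
            := b :* (c :* h₂ :- h :* c₂))
          S.refl (ι β) sinh cosh sinh₂ cosh₂))

      DQ : D Q ≋ P
      DQ = S.trans
        (S.+-cong (S.+-cong (S.*-congʳ D-cosh) (S.*-congˡ (S.trans D-sinh₂ (S.*-congʳ ι2))))
          (S.-‿cong (S.+-congˡ {cosh ⊛ cosh₂} (S.*-congˡ (S.trans D-cosh₂ (S.*-congʳ ι2))))))
        (solve 5 (λ b h c h₂ c₂ → let t = con (+ 2) in
          (b :* h :* h₂ :+ c :* (t :* c₂) :- (c :* c₂ :+ h :* (t :* (b :* h₂))))
            := (c :* c₂ :- b :* (h :* h₂)))
          S.refl (ι β) sinh cosh sinh₂ cosh₂)

      PQ : (P ≋ cosh) × (Q ≋ sinh)
      PQ = coshsinh-unique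
        (RS.solve 1 (λ b → let 1′ = RS.con (+ 1); 0′ = RS.con (+ 0) in
          (1′ RS.:* (1′ RS.:* 1′) RS.:- b RS.:* (0′ RS.:* (1′ RS.:* 0′))) RS.:= 1′) refl β)
        (let 1′ = RS.con (+ 1); 0′ = RS.con (+ 0) in
          RS.solve 0 ((1′ RS.:* (1′ RS.:* 0′) RS.:- 0′ RS.:* (1′ RS.:* 1′)) RS.:= 0′) refl)
        DP DQ

    cosh-subtraction : cosh ⊛ cosh₂ S.- ι β ⊛ (sinh ⊛ sinh₂) ≋ cosh
    cosh-subtraction = proj₁ PQ

    sinh-subtraction : cosh ⊛ sinh₂ S.- sinh ⊛ cosh₂ ≋ sinh
    sinh-subtraction = proj₂ PQ

-- Ascending lists of letters and words with distinct letters.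

Ascending : ℕ → List ℕ → Set
Ascending m L = AllPairs _<_ (m ∷ L)

Ascending-⊆ : ∀ {m A L} → A ⊆ L → Ascending m L → Ascending m A
Ascending-⊆ []             asc                  = asc
Ascending-⊆ (_ ∷ʳ A⊆L)     ((_ ∷ m<L) ∷ _ ∷ asc) = Ascending-⊆ A⊆L (m<L ∷ asc)
Ascending-⊆ (≡.refl ∷ A⊆L) ((m<a ∷ m<L) ∷ asc)  = (m<a ∷ All-resp-⊆ A⊆L m<L) ∷ Ascending-⊆ A⊆L asc

-- The head of an ascending list is inserted last, into a word whose letters all exceed it in
-- absolute value. This invariant ensures that neither sign of the new letter occurs in the word
-- already.
Good : ℕ → List ℤ → Set
Good m w = All (λ z → m < ∣ z ∣) w × AllPairs _≢_ w

All-insertAll : ∀ {P : ℤ → Set} {z w} → P z → All P w → All (All P) (insertAll z w)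
All-insertAll pz []       = (pz ∷ []) ∷ []
All-insertAll pz (pb ∷ pw) = (pz ∷ pb ∷ pw) ∷ Allₚ.map⁺ (All.map (pb ∷_) (All-insertAll pz pw))

AllPairs-insertAll : ∀ {z w} → All (z ≢_) w → AllPairs _≢_ w → All (AllPairs _≢_) (insertAll z w)
AllPairs-insertAll []          []         = ([] ∷ []) ∷ []
AllPairs-insertAll (z≢b ∷ z≢w) (b≢w ∷ w≢) =
  ((z≢b ∷ z≢w) ∷ b≢w ∷ w≢) ∷
  Allₚ.map⁺ (All.zipWith (λ (p , q) → p ∷ q)
    (All-insertAll (z≢b ∘ ≡.sym) b≢w , AllPairs-insertAll z≢w w≢))

fresh : ∀ {m z w} → ∣ z ∣ ≡ m → Good m w → All (z ≢_) w
fresh ∣z∣≡m (m<w , _) = All.map (λ m<b z≡b → ℕₚ.<⇒≢ m<b (≡.trans (≡.sym ∣z∣≡m) (≡.cong ∣_∣ z≡b))) m<w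

Good-insertAll : ∀ {m a z w} → m < a → ∣ z ∣ ≡ a → Good a w → All (Good m) (insertAll z w)
Good-insertAll m<a ≡.refl g@(a<w , w≢) = All.zipWith id
  ( All-insertAll m<a (All.map (ℕₚ.<-trans m<a) a<w)
  , AllPairs-insertAll (fresh ≡.refl g) w≢ )

-- Sums over signed arrangements.

module Words {r ℓ : Level} (R : CommutativeRing r ℓ) where
  open CommutativeRing R
  open Series R
  open IntegerSolver R
  open import Relation.Binary.Reasoning.Setoid setoid
  open import Algebra.Properties.CommutativeSemigroup +-commutativeSemigroup using (interchange)

  Fn : Set r
  Fn = List ℤ → Carrier

  infixl 6 _⊞_
  _⊞_ : Fn → Fn → Fn
  (φ ⊞ ψ) w = φ w + ψ w

  -- The adjoint of insertion: it acts on functions of words instead of producing lists, so that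
  -- linearity and the product rule become statements about functions.
  ins : ℤ → Fn → Fn
  ins z φ []      = φ (z ∷ [])
  ins z φ (b ∷ w) = φ (z ∷ b ∷ w) + ins z (φ ∘ (b ∷_)) w

  Δ : ℕ → Fn → Fn
  Δ a φ = ins (+ a) φ ⊞ ins (ℤ.- + a) φ

  -- The sum of φ over all signed arrangements of the letters of a list.
  E : List ℕ → Fn → Carrier
  E []      φ = φ []
  E (a ∷ L) φ = E L (Δ a φ)

  ins-congAll : ∀ {Q : List ℤ → Set} {φ ψ} z w → All Q (insertAll z w) →
                (∀ {w} → Q w → φ w ≈ ψ w) → ins z φ w ≈ ins z ψ w
  ins-congAll z []      (q ∷ []) eq = eq q
  ins-congAll z (b ∷ w) (q ∷ qs) eq = +-cong (eq q) (ins-congAll z w (Allₚ.map⁻ qs) eq)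

  ins-cong : ∀ {φ ψ} z w → (∀ w → φ w ≈ ψ w) → ins z φ w ≈ ins z ψ w
  ins-cong z []      eq = eq _
  ins-cong z (b ∷ w) eq = +-cong (eq _) (ins-cong z w (eq ∘ (b ∷_)))

  ins-+ : ∀ φ ψ z w → ins z (φ ⊞ ψ) w ≈ ins z φ w + ins z ψ w
  ins-+ φ ψ z []      = refl
  ins-+ φ ψ z (b ∷ w) =
    trans (+-congˡ (ins-+ (φ ∘ (b ∷_)) (ψ ∘ (b ∷_)) z w)) (interchange _ _ _ _)

  ins-length* : ∀ (k : Seq) φ z w → ins z (λ w → k (length w) * φ w) w ≈ k (suc (length w)) * ins z φ w
  ins-length* k φ z []      = refl
  ins-length* k φ z (b ∷ w) =
    trans (+-congˡ (ins-length* (k ∘ suc) (φ ∘ (b ∷_)) z w)) (sym (distribˡ _ _ _))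

  ins-*ˡ : ∀ d φ z w → ins z (λ w → d * φ w) w ≈ d * ins z φ w
  ins-*ˡ d = ins-length* (λ _ → d)

  ins-*ʳ : ∀ d φ z w → ins z (λ w → φ w * d) w ≈ ins z φ w * d
  ins-*ʳ d φ z w = trans (ins-cong z w (λ _ → *-comm _ d)) (trans (ins-*ˡ d φ z w) (*-comm d _))

  E-cong : ∀ {φ ψ} L → (∀ w → φ w ≈ ψ w) → E L φ ≈ E L ψ
  E-cong []      eq = eq []
  E-cong (a ∷ L) eq = E-cong L (λ w → +-cong (ins-cong (+ a) w eq) (ins-cong (ℤ.- + a) w eq))

  -- Arranging letters above m only ever evaluates the function at words satisfying `Good m`, so
  -- agreement there is enough.
  E-congGood : ∀ {φ ψ m L} → Ascending m L → (∀ {w} → Good m w → φ w ≈ ψ w) → E L φ ≈ E L ψ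
  E-congGood {L = []}    asc               eq = eq ([] , [])
  E-congGood {φ} {ψ} {m} {a ∷ L} ((m<a ∷ _) ∷ asc) eq = E-congGood asc λ {w} g → +-cong
    (ins-congAll (+ a) w (Good-insertAll m<a ≡.refl g) eq)
    (ins-congAll (ℤ.- + a) w (Good-insertAll m<a (ℤₚ.∣-i∣≡∣i∣ (+ a)) g) eq)

  E-+ : ∀ L φ ψ → E L (φ ⊞ ψ) ≈ E L φ + E L ψ
  E-+ []      φ ψ = refl
  E-+ (a ∷ L) φ ψ = trans
    (E-cong L (λ w → trans (+-cong (ins-+ φ ψ (+ a) w) (ins-+ φ ψ (ℤ.- + a) w)) (interchange _ _ _ _)))
    (E-+ L (Δ a φ) (Δ a ψ))

  E-length* : ∀ L (k : Seq) φ → E L (λ w → k (length w) * φ w) ≈ k (length L) * E L φ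
  E-length* []      k φ = refl
  E-length* (a ∷ L) k φ = trans
    (E-cong L (λ w → trans (+-cong (ins-length* k φ (+ a) w) (ins-length* k φ (ℤ.- + a) w)) (sym (distribˡ _ _ _))))
    (E-length* L (k ∘ suc) (Δ a φ))

  -- Deconcatenation of words and its product rule.

  conv : (List ℤ → Fn) → Fn
  conv Φ []      = Φ [] []
  conv Φ (b ∷ w) = Φ [] (b ∷ w) + conv (Φ ∘ (b ∷_)) w

  conv-cong : ∀ {Φ Ψ} w → (∀ u v → Φ u v ≈ Ψ u v) → conv Φ w ≈ conv Ψ w
  conv-cong []      eq = eq [] []
  conv-cong (b ∷ w) eq = +-cong (eq [] _) (conv-cong w (eq ∘ (b ∷_)))

  conv-+ : ∀ Φ Ψ w → conv (λ u → Φ u ⊞ Ψ u) w ≈ conv Φ w + conv Ψ w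
  conv-+ Φ Ψ []      = refl
  conv-+ Φ Ψ (b ∷ w) = trans (+-congˡ (conv-+ (Φ ∘ (b ∷_)) (Ψ ∘ (b ∷_)) w)) (interchange _ _ _ _)

  conv-*ˡ : ∀ d Φ w → conv (λ u v → d * Φ u v) w ≈ d * conv Φ w
  conv-*ˡ d Φ []      = refl
  conv-*ˡ d Φ (b ∷ w) = trans (+-congˡ (conv-*ˡ d (Φ ∘ (b ∷_)) w)) (sym (distribˡ _ _ _))

  -- A cut of the enlarged word leaves the inserted letter on one of its two sides, and deleting
  -- that letter gives a cut of the original word.
  ins-conv : ∀ z Φ w → ins z (conv Φ) w ≈
             conv (λ u v → ins z (λ u′ → Φ u′ v) u) w + conv (λ u v → ins z (Φ u) v) w
  ins-conv z Φ []      = +-comm _ _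
  ins-conv z Φ (b ∷ w) = begin
    (Φ [] (z ∷ b ∷ w) + (Φ (z ∷ []) (b ∷ w) + conv Φzb w)) + ins z (conv Φ ∘ (b ∷_)) w
      ≈⟨ +-congˡ (trans (ins-+ _ _ z w) (+-congˡ (ins-conv z (Φ ∘ (b ∷_)) w))) ⟩
    (Φ [] (z ∷ b ∷ w) + (Φ (z ∷ []) (b ∷ w) + conv Φzb w))
      + (ins z (Φ [] ∘ (b ∷_)) w + (conv Φₗ w + conv Φᵣ w))
      ≈⟨ solve 6 (λ p q r s t k → ((p :+ (q :+ r)) :+ (s :+ (t :+ k)))
                               := ((q :+ (r :+ t)) :+ ((p :+ s) :+ k))) refl _ _ _ _ _ _ ⟩
    (Φ (z ∷ []) (b ∷ w) + (conv Φzb w + conv Φₗ w))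
      + ((Φ [] (z ∷ b ∷ w) + ins z (Φ [] ∘ (b ∷_)) w) + conv Φᵣ w)
      ≈⟨ +-congʳ (+-congˡ (conv-+ Φzb Φₗ w)) ⟨
    (Φ (z ∷ []) (b ∷ w) + conv (λ u → Φzb u ⊞ Φₗ u) w)
      + ((Φ [] (z ∷ b ∷ w) + ins z (Φ [] ∘ (b ∷_)) w) + conv Φᵣ w) ∎
    where
    Φzb Φₗ Φᵣ : List ℤ → Fn
    Φzb u v = Φ (z ∷ b ∷ u) v
    Φₗ u v = ins z (λ u′ → Φ (b ∷ u′) v) u
    Φᵣ u v = ins z (Φ (b ∷ u)) v

  infixl 7 _⋆_
  _⋆_ : Fn → Fn → Fn
  φ ⋆ ψ = conv (λ u v → φ u * ψ v)

  ins-⋆ : ∀ φ ψ z w → ins z (φ ⋆ ψ) w ≈ (ins z φ ⋆ ψ) w + (φ ⋆ ins z ψ) w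
  ins-⋆ φ ψ z w = trans (ins-conv z _ w) (+-cong
    (conv-cong w (λ u v → ins-*ʳ (ψ v) φ z u))
    (conv-cong w (λ u v → ins-*ˡ (φ u) ψ z v)))

  Δ-⋆ : ∀ φ ψ a w → Δ a (φ ⋆ ψ) w ≈ (Δ a φ ⋆ ψ) w + (φ ⋆ Δ a ψ) w
  Δ-⋆ φ ψ a w = begin
    ins z (φ ⋆ ψ) w + ins z′ (φ ⋆ ψ) w
      ≈⟨ +-cong (ins-⋆ φ ψ z w) (ins-⋆ φ ψ z′ w) ⟩
    ((ins z φ ⋆ ψ) w + (φ ⋆ ins z ψ) w) + ((ins z′ φ ⋆ ψ) w + (φ ⋆ ins z′ ψ) w)
      ≈⟨ interchange _ _ _ _ ⟩
    ((ins z φ ⋆ ψ) w + (ins z′ φ ⋆ ψ) w) + ((φ ⋆ ins z ψ) w + (φ ⋆ ins z′ ψ) w)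
      ≈⟨ +-cong (conv-+ _ _ w) (conv-+ _ _ w) ⟨
    conv (λ u v → ins z φ u * ψ v + ins z′ φ u * ψ v) w + conv (λ u v → φ u * ins z ψ v + φ u * ins z′ ψ v) w
      ≈⟨ +-cong (conv-cong w (λ _ _ → distribʳ _ _ _)) (conv-cong w (λ _ _ → distribˡ _ _ _)) ⟨
    (Δ a φ ⋆ ψ) w + (φ ⋆ Δ a ψ) w ∎
    where
    z z′ : ℤ
    z  = + a
    z′ = ℤ.- + a

  -- The product rule sends each letter to exactly one factor, which is the Leibniz recursion of
  -- `⊛`. The letters received by a factor form a sublist, hence hypotheses about all sublists.
  E-⋆ : ∀ L φ ψ f g →
        (∀ {A} → A ⊆ L → E A φ ≈ f (length A)) → (∀ {A} → A ⊆ L → E A ψ ≈ g (length A)) →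
        E L (φ ⋆ ψ) ≈ (f ⊛ g) (length L)
  E-⋆ []      φ ψ f g hφ hψ = *-cong (hφ []) (hψ [])
  E-⋆ (a ∷ L) φ ψ f g hφ hψ = trans
    (trans (E-cong L (Δ-⋆ φ ψ a)) (E-+ L _ _))
    (+-cong (E-⋆ L (Δ a φ) ψ (D f) g (hφ ∘ (≡.refl ∷_)) (hψ ∘ (a ∷ʳ_)))
            (E-⋆ L φ (Δ a ψ) f (D g) (hφ ∘ (a ∷ʳ_)) (hψ ∘ (≡.refl ∷_))))

  -- As ψ vanishes on the empty word, φ is only evaluated on proper sublists, so that E-⋆ can be
  -- applied in an induction on the length of L.
  E-⋆-proper : ∀ L φ ψ f g → ψ [] ≈ 0# → g 0 ≈ 0# →
    (∀ {A} → A ⊆ L → length A < length L → E A φ ≈ f (length A)) →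
    (∀ {A} → A ⊆ L → E A ψ ≈ g (length A)) →
    E L (φ ⋆ ψ) ≈ (f ⊛ g) (length L)
  E-⋆-proper []      φ ψ f g ψ0 g0 hφ hψ =
    trans (trans (*-congˡ ψ0) (zeroʳ _)) (sym (trans (*-congˡ g0) (zeroʳ _)))
  E-⋆-proper (a ∷ L) φ ψ f g ψ0 g0 hφ hψ = trans
    (trans (E-cong L (Δ-⋆ φ ψ a)) (E-+ L _ _))
    (+-cong (E-⋆-proper L (Δ a φ) ψ (D f) g ψ0 g0 (λ A⊆L lt → hφ (≡.refl ∷ A⊆L) (s<s lt)) (hψ ∘ (a ∷ʳ_)))
            (E-⋆ L φ (Δ a ψ) f (D g) (λ A⊆L → hφ (a ∷ʳ A⊆L) (ℕ.s≤s (length-mono-≤ A⊆L))) (hψ ∘ (≡.refl ∷_))))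

  -- The enumeration of signed permutations as iterated insertion.

  sumR-++ : ∀ xs ys → sumR R (xs ++ ys) ≈ sumR R xs + sumR R ys
  sumR-++ []       ys = sym (+-identityˡ _)
  sumR-++ (x ∷ xs) ys = trans (+-congˡ (sumR-++ xs ys)) (sym (+-assoc _ _ _))

  module _ {A : Set} where

    sum : List A → (A → Carrier) → Carrier
    sum l φ = sumR R (map φ l)

    sum-cong : ∀ l {φ ψ : A → Carrier} → (∀ x → φ x ≈ ψ x) → sum l φ ≈ sum l ψ
    sum-cong []      eq = refl
    sum-cong (x ∷ l) eq = +-cong (eq x) (sum-cong l eq)

    sum-+ : ∀ l (φ ψ : A → Carrier) → sum l (λ x → φ x + ψ x) ≈ sum l φ + sum l ψ
    sum-+ []      φ ψ = sym (+-identityˡ 0#)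
    sum-+ (x ∷ l) φ ψ = trans (+-congˡ (sum-+ l φ ψ)) (interchange _ _ _ _)

    sum-concatMap : ∀ {B : Set} (f : B → List A) (φ : A → Carrier) l →
                    sumR R (map φ (concatMap f l)) ≈ sumR R (map (λ x → sum (f x) φ) l)
    sum-concatMap f φ []      = refl
    sum-concatMap f φ (x ∷ l) = begin
      sumR R (map φ (f x ++ concatMap f l))              ≡⟨ ≡.cong (sumR R) (map-++ φ (f x) _) ⟩
      sumR R (map φ (f x) ++ map φ (concatMap f l))      ≈⟨ sumR-++ (map φ (f x)) _ ⟩
      sum (f x) φ + sum (concatMap f l) φ                ≈⟨ +-congˡ (sum-concatMap f φ l) ⟩
      sum (f x) φ + sumR R (map (λ x → sum (f x) φ) l)   ∎

  sum-map : ∀ {A B : Set} (f : A → B) (φ : B → Carrier) l → sum (map f l) φ ≈ sum l (φ ∘ f)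
  sum-map f φ []      = refl
  sum-map f φ (x ∷ l) = +-congˡ (sum-map f φ l)

  sum-signings-∷ : ∀ a l φ → sum (signings (a ∷ l)) φ ≈
                   sum (signings l) (λ s → φ (+ a ∷ s) + φ (ℤ.- + a ∷ s))
  sum-signings-∷ a l φ = trans (sum-concatMap _ φ (signings l))
    (sum-cong (signings l) (λ s → +-congˡ (+-identityʳ _)))

  -- Inserting an unsigned letter and then choosing all signs amounts to choosing the other signs
  -- first and then inserting both signed copies. This links `perms` and `signings` to the recursion
  -- of `E`.
  sum-insert-signings : ∀ a l φ → sum (insertAll a l) (λ l′ → sum (signings l′) φ) ≈
                        sum (signings l) (Δ a φ)
  sum-insert-signings a []      φ = begin
    sum (signings (a ∷ [])) φ + 0#  ≈⟨ +-identityʳ _ ⟩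
    φ (+ a ∷ []) + (φ (ℤ.- + a ∷ []) + 0#)  ≈⟨ +-assoc _ _ _ ⟨
    (φ (+ a ∷ []) + φ (ℤ.- + a ∷ [])) + 0#  ∎
  sum-insert-signings a (b ∷ l) φ = begin
    sum (signings (a ∷ b ∷ l)) φ + sum (map (b ∷_) (insertAll a l)) (λ l′ → sum (signings l′) φ)
      ≈⟨ +-cong (trans (sum-signings-∷ a (b ∷ l) φ) (sum-signings-∷ b l _))
                (trans (sum-map (b ∷_) _ (insertAll a l))
                       (sum-cong (insertAll a l) (λ l′ → sum-signings-∷ b l′ φ))) ⟩
    sum (signings l) φ₁ + sum (insertAll a l) (λ l′ → sum (signings l′) φ₂)
      ≈⟨ +-congˡ (sum-insert-signings a l φ₂) ⟩
    sum (signings l) φ₁ + sum (signings l) (Δ a φ₂)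
      ≈⟨ sum-+ (signings l) φ₁ (Δ a φ₂) ⟨
    sum (signings l) (λ s → φ₁ s + Δ a φ₂ s)
      ≈⟨ sum-cong (signings l) regroup ⟩
    sum (signings l) (λ s → Δ a φ (+ b ∷ s) + Δ a φ (ℤ.- + b ∷ s))
      ≈⟨ sum-signings-∷ b l (Δ a φ) ⟨
    sum (signings (b ∷ l)) (Δ a φ) ∎
    where
    φ₁ φ₂ : Fn
    φ₁ s = (φ (+ a ∷ + b ∷ s) + φ (ℤ.- + a ∷ + b ∷ s)) + (φ (+ a ∷ ℤ.- + b ∷ s) + φ (ℤ.- + a ∷ ℤ.- + b ∷ s))
    φ₂ s = φ (+ b ∷ s) + φ (ℤ.- + b ∷ s)

    regroup : ∀ s → φ₁ s + Δ a φ₂ s ≈ Δ a φ (+ b ∷ s) + Δ a φ (ℤ.- + b ∷ s)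
    regroup s = trans (+-congˡ (+-cong (ins-+ _ _ (+ a) s) (ins-+ _ _ (ℤ.- + a) s)))
      (solve 8 (λ p q r t i j k m →
        (((p :+ q) :+ (r :+ t)) :+ ((i :+ j) :+ (k :+ m)))
          := (((p :+ i) :+ (q :+ k)) :+ ((r :+ j) :+ (t :+ m)))) refl _ _ _ _ _ _ _ _)

  sum-signings-perms : ∀ L φ → sum (concatMap signings (perms L)) φ ≈ E L φ
  sum-signings-perms L φ = trans (sum-concatMap signings φ (perms L)) (sum-perms L φ)
    where
    sum-perms : ∀ L φ → sum (perms L) (λ l → sum (signings l) φ) ≈ E L φ
    sum-perms []      φ = trans (+-identityʳ _) (+-identityʳ _)
    sum-perms (a ∷ L) φ = begin
      sum (concatMap (insertAll a) (perms L)) (λ l → sum (signings l) φ)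
        ≈⟨ sum-concatMap (insertAll a) _ (perms L) ⟩
      sum (perms L) (λ l → sum (insertAll a l) (λ l′ → sum (signings l′) φ))
        ≈⟨ sum-cong (perms L) (λ l → sum-insert-signings a l φ) ⟩
      sum (perms L) (λ l → sum (signings l) (Δ a φ))
        ≈⟨ sum-perms L (Δ a φ) ⟩
      E L (Δ a φ) ∎

-- Increasing blocks and the expansion of the weights.

neg<0 : ∀ {m a} → m < a → ℤ.- + a ℤ.< + 0
neg<0 {a = suc a} _ = ℤ.-<+

module Blocks {r ℓ : Level} (R : CommutativeRing r ℓ) (x y : CommutativeRing.Carrier R) where
  open CommutativeRing R
  open Series R
  open Hyperbolic R
  open Words R
  open IntegerSolver R
  open import Relation.Binary.Reasoning.Setoid setoid

  lt : ℤ → ℤ → Carrier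
  lt a b = if ⌊ a ℤₚ.<? b ⌋ then 1# else 0#

  lt-true : ∀ {a b} → a ℤ.< b → lt a b ≈ 1#
  lt-true {a} {b} a<b with a ℤₚ.<? b
  ... | yes _   = refl
  ... | no a≮b = contradiction a<b a≮b

  lt-false : ∀ {a b} → ¬ a ℤ.< b → lt a b ≈ 0#
  lt-false {a} {b} a≮b with a ℤₚ.<? b
  ... | yes a<b = contradiction a<b a≮b
  ... | no _    = refl

  incFrom : ℤ → Fn
  incFrom c []      = 1#
  incFrom c (b ∷ w) = lt c b * incFrom b w

  inc : Fn
  inc []      = 1#
  inc (b ∷ w) = incFrom b w

  -- A letter below `c` has no place in a chain increasing from `c`.
  ins-incFrom-> : ∀ {c z} w → z ℤ.< c → ins z (incFrom c) w ≈ 0#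
  ins-incFrom-> []      z<c = trans (*-congʳ (lt-false (ℤₚ.<-asym z<c))) (zeroˡ _)
  ins-incFrom-> {c} {z} (b ∷ w) z<c = trans
    (+-cong (trans (*-congʳ (lt-false (ℤₚ.<-asym z<c))) (zeroˡ _)) (trans (ins-*ˡ _ (incFrom b) z w) tail))
    (+-identityˡ 0#)
    where
    tail : lt c b * ins z (incFrom b) w ≈ 0#
    -- If c < b then z < b too and the induction applies; otherwise the pair c, b already
    -- contributes 0.
    tail with c ℤₚ.<? b
    ... | yes c<b = trans (*-congˡ (ins-incFrom-> w (ℤₚ.<-trans z<c c<b))) (zeroʳ _)
    ... | no _    = zeroˡ _

  -- An increasing chain has exactly one slot for a new letter, and an insertion cannot repair a
  -- chain that fails to increase.
  ins-incFrom-< : ∀ {c z} w → c ℤ.< z → All (z ≢_) w → ins z (incFrom c) w ≈ incFrom c w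
  ins-incFrom-< []      c<z _ = trans (*-congʳ (lt-true c<z)) (*-identityˡ _)
  ins-incFrom-< {c} {z} (b ∷ w) c<z (z≢b ∷ z≢w) = trans (+-congˡ (ins-*ˡ _ (incFrom b) z w)) split
    where
    split : lt c z * (lt z b * incFrom b w) + lt c b * ins z (incFrom b) w ≈ lt c b * incFrom b w
    split with ℤₚ.<-cmp z b
    ... | tri≈ _ z≡b _ = contradiction z≡b z≢b
    ... | tri> z≮b _ b<z = trans
      (+-cong (*-congˡ (*-congʳ (lt-false z≮b))) (*-congˡ (ins-incFrom-< w b<z z≢w)))
      (solve 3 (λ p q i → (p :* (con (+ 0) :* i) :+ q :* i) := q :* i) refl _ _ _)
    ... | tri< z<b _ _ = trans
      (+-cong (*-cong (lt-true c<z) (*-congʳ (lt-true z<b)))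
              (*-cong (lt-true (ℤₚ.<-trans c<z z<b)) (ins-incFrom-> w z<b)))
      (trans (solve 1 (λ i → (con (+ 1) :* (con (+ 1) :* i) :+ con (+ 1) :* con (+ 0)) := con (+ 1) :* i) refl _)
             (*-congʳ (sym (lt-true (ℤₚ.<-trans c<z z<b)))))

  ins-inc : ∀ {z} w → All (z ≢_) w → ins z inc w ≈ inc w
  ins-inc []      _ = refl
  ins-inc {z} (b ∷ w) (z≢b ∷ z≢w) with ℤₚ.<-cmp z b
  ... | tri≈ _ z≡b _ = contradiction z≡b z≢b
  ... | tri> z≮b _ b<z = trans
    (+-cong (trans (*-congʳ (lt-false z≮b)) (zeroˡ _)) (ins-incFrom-< w b<z z≢w)) (+-identityˡ _)
  ... | tri< z<b _ _ = trans
    (+-cong (trans (*-congʳ (lt-true z<b)) (*-identityˡ _)) (ins-incFrom-> w z<b)) (+-identityʳ _)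

  -- A chain increasing from 0 has positive letters only, so all signs and the order are forced.
  E-incFrom0 : ∀ {m} L → Ascending m L → E L (incFrom (+ 0)) ≈ 1#
  E-incFrom0 []      _ = refl
  E-incFrom0 (a ∷ L) ((m<a ∷ _) ∷ asc) = trans
    (E-congGood asc (λ {w} g → trans
      (+-cong (ins-incFrom-< w (ℤ.+<+ (ℕₚ.≤-<-trans ℕ.z≤n m<a)) (fresh ≡.refl g)) (ins-incFrom-> w (neg<0 m<a)))
      (+-identityʳ _)))
    (E-incFrom0 L asc)

  -- Each choice of signs leaves exactly one increasing order.
  E-inc : ∀ {m} L → Ascending m L → E L inc ≈ pow R 2# (length L)
  E-inc []      _ = refl
  E-inc (a ∷ L) (_ ∷ asc) = begin
    E L (Δ a inc)
      ≈⟨ E-congGood asc (λ {w} g → trans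
           (+-cong (ins-inc w (fresh ≡.refl g)) (ins-inc w (fresh (ℤₚ.∣-i∣≡∣i∣ (+ a)) g)))
           (solve 1 (λ i → i :+ i := con (+ 2) :* i) refl _)) ⟩
    E L (λ w → 2# * inc w)       ≈⟨ E-length* L (λ _ → 2#) inc ⟩
    2# * E L inc                 ≈⟨ *-congˡ (E-inc L asc) ⟩
    2# * pow R 2# (length L)     ∎

  -- An adjacent pair at a position of parity p has weight cut p + link p * [ascent];
  -- for odd positions this relies on the two letters being distinct.
  cut link : Bool → Carrier
  cut true   = 1#
  cut false  = x
  link true  = y - 1#
  link false = 1# - x

  weight : Bool → ℤ → ℤ → Carrier
  weight p c b = cut p + link p * lt c b

  W : Bool → ℤ → Fn
  W p c []      = 1#
  W p c (b ∷ w) = weight p c b * W (not p) b w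

  links : Bool → Seq
  links p zero    = 1#
  links p (suc m) = link p * links (not p) m

  -- A block opens with a cut, so it has one link fewer than letters, and the empty block gets
  -- weight 0.
  block : Bool → Seq
  block p zero    = 0#
  block p (suc m) = cut p * links (not p) m

  -- Flipping the argument `p`, rather than the result, lets `lastCut` unfold letter by letter
  -- together with `W`.
  parityAfter : Bool → ℕ → Bool
  parityAfter p zero    = p
  parityAfter p (suc n) = parityAfter (not p) n

  parityAfter-not : ∀ p n → parityAfter (not p) n ≡ not (parityAfter p n)
  parityAfter-not p zero    = ≡.refl
  parityAfter-not p (suc n) = parityAfter-not (not p) n

  parityAfter-true : ∀ n → parityAfter true n ≡ isEven n
  parityAfter-true zero    = ≡.refl
  parityAfter-true (suc n) = ≡.trans (parityAfter-not true n) (≡.cong not (parityAfter-true n))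

  -- The terms whose last cut separates `u` from `v`: full weights within `u`, then the cut, then
  -- only ascent indicators within `v`.
  lastCut : Bool → ℤ → List ℤ → Fn
  lastCut p c u v = W p c u * (block (parityAfter p (length u)) (length v) * inc v)

  -- Expand the product of all weights and collect the terms by their last cut.
  W-lastBlock : ∀ p c w →
    W p c w ≈ links p (length w) * incFrom c w + conv (lastCut p c) w
  W-lastBlock p c [] =
    solve 0 (let 1′ = con (+ 1) in 1′ := 1′ :* 1′ :+ 1′ :* (con (+ 0) :* 1′)) refl
  W-lastBlock p c (b ∷ w) = begin
    weight p c b * W (not p) b w
      ≈⟨ *-congˡ (W-lastBlock (not p) b w) ⟩
    (cut p + link p * lt c b) * (links (not p) (length w) * incFrom b w + conv Φ w)
      -- The three resulting summands correspond to no cut at all, a last cut before `b`, and a last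
      -- cut further right.
      ≈⟨ solve 6 (λ a l t k i C → ((a :+ l :* t) :* (k :* i :+ C)) :=
           (l :* k :* (t :* i) :+ (con (+ 1) :* (a :* k :* i) :+ (a :+ l :* t) :* C))) refl _ _ _ _ _ _ ⟩
    links p (suc (length w)) * incFrom c (b ∷ w) +
      (1# * (block p (suc (length w)) * inc (b ∷ w)) + weight p c b * conv Φ w)
      ≈⟨ +-congˡ (+-congˡ (trans (conv-cong w (λ _ _ → *-assoc _ _ _)) (conv-*ˡ _ Φ w))) ⟨
    links p (suc (length w)) * incFrom c (b ∷ w) + conv (lastCut p c) (b ∷ w) ∎
    where
    Φ : List ℤ → Fn
    Φ = lastCut (not p) b

  restrict : Bool → Seq → Seq
  restrict true  f k = (if isEven k then 1# else 0#) * f k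
  restrict false f k = (if isEven k then 0# else 1#) * f k

  B : Fn
  B = W true (+ 0)

  B∣ : Bool → Fn
  B∣ p w = restrict p (λ _ → 1#) (length w) * B w

  blockInc : Bool → Fn
  blockInc p v = block p (length v) * inc v

  -- The weight of the last block depends on the prefix through the parity of its length, which is
  -- the position of the cut. Splitting the prefixes by this parity turns the sum over cuts into two
  -- genuine products.
  B-lastBlock : ∀ w → B w ≈ links true (length w) * incFrom (+ 0) w +
    ((B∣ true ⋆ blockInc true) w + (B∣ false ⋆ blockInc false) w)
  B-lastBlock w = trans (W-lastBlock true (+ 0) w)
    (+-congˡ (trans (conv-cong w byParity) (conv-+ _ _ w)))
    where
    byParity : ∀ u v → lastCut true (+ 0) u v ≈
                       B∣ true u * blockInc true v + B∣ false u * blockInc false v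
    byParity u v rewrite parityAfter-true (length u) with isEven (length u)
    ... | true  = solve 3 (λ b k l → b :* k :=
                    con (+ 1) :* con (+ 1) :* b :* k :+ con (+ 0) :* con (+ 1) :* b :* l) refl _ _ _
    ... | false = solve 3 (λ b k l → b :* k :=
                    con (+ 0) :* con (+ 1) :* b :* l :+ con (+ 1) :* con (+ 1) :* b :* k) refl _ _ _

  scaled : Seq → Seq
  scaled f k = f k * pow R 2# k

  lastBlockSeries : Seq → Seq
  lastBlockSeries f k = links true k +
    ((restrict true f ⊛ scaled (block true)) k + (restrict false f ⊛ scaled (block false)) k)

  -- The last block is nonempty, so the prefixes use proper sublists only, and the result depends on
  -- `L` through its length alone.
  E-B-step : ∀ {m} L f → Ascending m L →
             (∀ {A} → A ⊆ L → length A < length L → E A B ≈ f (length A)) →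
             E L B ≈ lastBlockSeries f (length L)
  E-B-step L f asc hyp = begin
    E L B
      ≈⟨ E-cong L B-lastBlock ⟩
    E L ((λ w → links true (length w) * incFrom (+ 0) w) ⊞ (B∣ true ⋆ blockInc true ⊞ B∣ false ⋆ blockInc false))
      ≈⟨ trans (E-+ L _ _) (+-congˡ (E-+ L _ _)) ⟩
    E L (λ w → links true (length w) * incFrom (+ 0) w)
      + (E L (B∣ true ⋆ blockInc true) + E L (B∣ false ⋆ blockInc false))
      ≈⟨ +-cong (trans (E-length* L (links true) _) (trans (*-congˡ (E-incFrom0 L asc)) (*-identityʳ _)))
                (+-cong (product true) (product false)) ⟩
    lastBlockSeries f (length L) ∎
    where
    restricted : ∀ p k → restrict p (λ _ → 1#) k * f k ≈ restrict p f k
    restricted true  k = *-congʳ (*-identityʳ _)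
    restricted false k = *-congʳ (*-identityʳ _)

    product : ∀ p → E L (B∣ p ⋆ blockInc p) ≈ (restrict p f ⊛ scaled (block p)) (length L)
    product p = E-⋆-proper L (B∣ p) (blockInc p) (restrict p f) (scaled (block p)) (zeroˡ _) (zeroˡ _)
      (λ {A} A⊆L A<L → trans (E-length* A (restrict p (λ _ → 1#)) B)
                             (trans (*-congˡ (hyp A⊆L A<L)) (restricted p (length A))))
      (λ {A} A⊆L → trans (E-length* A (block p) inc) (*-congˡ (E-inc A (Ascending-⊆ A⊆L asc))))

  -- The recursion for the sums over signed permutations.

  letters : ℕ → List ℕ
  letters n = map suc (upTo n)

  letters-ascending : ∀ n → Ascending 0 (letters n)
  letters-ascending n =
    Allₚ.map⁺ (All.universal (λ _ → z<s) (upTo n)) ∷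
    AllPairsₚ.map⁺ (AllPairsₚ.applyUpTo⁺₁ id n (λ i<j _ → s<s i<j))

  length-letters : ∀ n → length (letters n) ≡ n
  length-letters n = ≡.trans (length-map suc (upTo n)) (length-upTo n)

  bseq : Seq
  bseq n = E (letters n) B

  -- `E-B-step` gives `E L B` and `bseq n` the same expression in earlier values. Independence of
  -- the actual letters is needed because prefixes use arbitrary sublists.
  E-B : ∀ n L → length L ≡ n → Ascending 0 L → E L B ≈ bseq n
  E-B = <-rec _ λ n rec L len asc →
    let smaller : ∀ {L′ A} → length L′ ≡ n → Ascending 0 L′ → A ⊆ L′ → length A < length L′ → E A B ≈ bseq (length A)
        smaller {A = A} len′ asc′ A⊆L′ A<L′ =
          rec (≡.subst (length A <_) len′ A<L′) A ≡.refl (Ascending-⊆ A⊆L′ asc′)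
    in begin
      E L B                                   ≈⟨ E-B-step L bseq asc (smaller len asc) ⟩
      lastBlockSeries bseq (length L)         ≡⟨ ≡.cong (lastBlockSeries bseq) (≡.trans len (≡.sym (length-letters n))) ⟩
      lastBlockSeries bseq (length (letters n))
        ≈⟨ E-B-step (letters n) bseq (letters-ascending n) (smaller (length-letters n) (letters-ascending n)) ⟨
      bseq n                                  ∎

  bseq-lastBlock : bseq ≋ lastBlockSeries bseq
  bseq-lastBlock n = trans
    (E-B-step (letters n) bseq (letters-ascending n) (λ {A} A⊆L _ → E-B _ A ≡.refl (Ascending-⊆ A⊆L (letters-ascending n))))
    (reflexive (≡.cong (lastBlockSeries bseq) (length-letters n)))

  -- An even position contributes y to the power [ascent], an odd one x to the power [descent]; for
  -- distinct letters a pair that does not ascend must descend.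
  weight-stat : ∀ p {c b} → c ≢ b → ∀ d e →
    pow R x ((if not p ∧ ⌊ b ℤₚ.<? c ⌋ then 1 else 0) ℕ.+ d) *
    pow R y ((if p ∧ ⌊ c ℤₚ.<? b ⌋ then 1 else 0) ℕ.+ e) ≈ weight p c b * (pow R x d * pow R y e)
  weight-stat true {c} {b} c≢b d e with c ℤₚ.<? b
  ... | yes _ = solve 3 (λ y p q → p :* (y :* q) := (con (+ 1) :+ (y :- con (+ 1)) :* con (+ 1)) :* (p :* q)) refl _ _ _
  ... | no _  = solve 3 (λ y p q → p :* q := (con (+ 1) :+ (y :- con (+ 1)) :* con (+ 0)) :* (p :* q)) refl y _ _
  weight-stat false {c} {b} c≢b d e with ℤₚ.<-cmp c b
  ... | tri≈ _ c≡b _ = contradiction c≡b c≢b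
  ... | tri< c<b _ b≮c with c ℤₚ.<? b | b ℤₚ.<? c
  ...   | yes _ | no _ = solve 3 (λ x p q → p :* q := (x :+ (con (+ 1) :- x) :* con (+ 1)) :* (p :* q)) refl x _ _
  ...   | no c≮b | _ = contradiction c<b c≮b
  ...   | _ | yes b<c = contradiction b<c b≮c
  weight-stat false {c} {b} c≢b d e | tri> c≮b _ b<c with c ℤₚ.<? b | b ℤₚ.<? c
  ...   | no _ | yes _ = solve 3 (λ x p q → x :* p :* q := (x :+ (con (+ 1) :- x) :* con (+ 0)) :* (p :* q)) refl _ _ _
  ...   | yes c<b | _ = contradiction c<b c≮b
  ...   | _ | no b≮c = contradiction b<c b≮c

  W-stat : ∀ i c w → AllPairs _≢_ (c ∷ w) →
           pow R x (desOddFrom i (c ∷ w)) * pow R y (ascEvenFrom i (c ∷ w)) ≈ W (isEven i) c w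
  W-stat i c []      _ = *-identityˡ 1#
  W-stat i c (b ∷ w) ((c≢b ∷ _) ∷ w≢) =
    trans (weight-stat (isEven i) c≢b _ _) (*-congˡ (W-stat (suc i) b w w≢))

  Bhat≋bseq : ∀ n → Bhat R x y n ≈ bseq n
  Bhat≋bseq n = trans (sum-signings-perms (letters n) _)
    (E-congGood (letters-ascending n) λ {w} (pos , w≢) →
      -- The initial 0 differs from every letter, since letters have positive absolute value.
      W-stat 0 (+ 0) w (All.map (λ 0<b 0≡b → ℕₚ.<⇒≢ 0<b (≡.cong ∣_∣ 0≡b)) pos ∷ w≢))

-- The linear system for the even and odd generating functions.

module GeneratingFunctions {r ℓ : Level} (R : CommutativeRing r ℓ) (x y : CommutativeRing.Carrier R) where
  open CommutativeRing R
  open Series R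
  open Hyperbolic R
  open Blocks R x y
  open IntegerSolver R
  open import Relation.Binary.Reasoning.Setoid setoid
  private
    module S = CommutativeRing seriesRing
    open Elimination seriesRing using (collect; pred-*; module LinearSystem)

  -- The product (y - 1)(1 - x) of the two link factors.
  β : Carrier
  β = - α R x y

  X Y U V fₑ fₒ : Seq
  X  = ι x
  Y  = ι y
  U  = Y S.- S.1#
  V  = S.1# S.- X
  fₑ = restrict true bseq
  fₒ = restrict false bseq

  ι-minus : ∀ a b → ι a S.- ι b ≋ ι (a - b)
  ι-minus a b zero    = refl
  ι-minus a b (suc k) = -‿inverseʳ 0#

  U-⊛ : ∀ a k → (U ⊛ a) k ≈ (y - 1#) * a k
  U-⊛ a k = trans (⊛-cong {b = a} (ι-minus y 1#) (λ _ → refl) k) (ι-⊛ _ a k)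

  V-⊛ : ∀ a k → (V ⊛ a) k ≈ (1# - x) * a k
  V-⊛ a k = trans (⊛-cong {b = a} (ι-minus 1# x) (λ _ → refl) k) (ι-⊛ _ a k)

  ιβ≋UV : ι β ≋ U ⊛ V
  ιβ≋UV k = sym (trans (U-⊛ V k) (at k))
    where
    at : ∀ k → (y - 1#) * V k ≈ ι β k
    at zero    = solve 2 (λ x y → let 1′ = con (+ 1) in
                   (y :- 1′) :* (1′ :- x) := :- ((1′ :- x) :* (1′ :- y))) refl x y
    at (suc k) = trans (*-congˡ (-‿inverseʳ 0#)) (zeroʳ _)

  -- Alternating link factors pair off into powers of β; an odd number of them leaves one extra
  -- factor `link p`.
  links-coshsinh : ∀ p k → links p k ≈ cosh β k + link p * sinh β k
  links-coshsinh p     zero    = solve 1 (λ l → con (+ 1) := con (+ 1) :+ l :* con (+ 0)) refl _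
  links-coshsinh true  (suc k) = trans (*-congˡ (links-coshsinh false k))
    (solve 4 (λ x y c s → let 1′ = con (+ 1) in
      (y :- 1′) :* (c :+ (1′ :- x) :* s) := (:- ((1′ :- x) :* (1′ :- y))) :* s :+ (y :- 1′) :* c)
      refl x y _ _)
  links-coshsinh false (suc k) = trans (*-congˡ (links-coshsinh true k))
    (solve 4 (λ x y c s → let 1′ = con (+ 1) in
      (1′ :- x) :* (c :+ (y :- 1′) :* s) := (:- ((1′ :- x) :* (1′ :- y))) :* s :+ (1′ :- x) :* c)
      refl x y _ _)

  -- The opening cut shifts the index by one, that is, integrates: cosine turns into sine, and sine
  -- into (cosine - 1)/β, whence `versinh₂`.
  block-true : scaled (block true) ≋ V ⊛ versinh₂ β S.+ sinh₂ β
  block-true k = trans (at k) (sym (+-congʳ (V-⊛ (versinh₂ β) k)))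
    where
    at : ∀ k → scaled (block true) k ≈ (1# - x) * versinh₂ β k + sinh₂ β k
    at zero    = solve 1 (λ v → let 1′ = con (+ 1); 0′ = con (+ 0) in
                   0′ :* 1′ := v :* 0′ :+ 1′ :* 0′) refl _
    at (suc k) = trans (*-congʳ (*-congˡ (links-coshsinh false k)))
      (solve 4 (λ v c s p → con (+ 1) :* (c :+ v :* s) :* p := v :* (p :* s) :+ p :* c) refl _ _ _ _)

  block-false : scaled (block false) ≋ X ⊛ U ⊛ versinh₂ β S.+ X ⊛ sinh₂ β
  block-false k = trans (at k) (sym (+-cong
      (trans (⊛-assoc X U _ k) (trans (ι-⊛ x _ k) (*-congˡ (U-⊛ (versinh₂ β) k))))
      (ι-⊛ x _ k)))
    where
    at : ∀ k → scaled (block false) k ≈ x * ((y - 1#) * versinh₂ β k) + x * sinh₂ β k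
    at zero    = solve 2 (λ x u → let 1′ = con (+ 1); 0′ = con (+ 0) in
                   0′ :* 1′ := x :* (u :* 0′) :+ x :* (1′ :* 0′)) refl _ _
    at (suc k) = trans (*-congʳ (*-congˡ (links-coshsinh true k)))
      (solve 5 (λ x u c s p → x :* (c :+ u :* s) :* p := x :* (u :* (p :* s)) :+ x :* (p :* c)) refl _ _ _ _ _)

  restrict-sum : ∀ f k → restrict true f k + restrict false f k ≈ f k
  restrict-sum f k with isEven k
  ... | true  = solve 1 (λ a → con (+ 1) :* a :+ con (+ 0) :* a := a) refl _
  ... | false = solve 1 (λ a → con (+ 0) :* a :+ con (+ 1) :* a := a) refl _

  restrict-parity : ∀ p f → HasParity p (restrict p f)
  restrict-parity true  f k eq rewrite eq = zeroˡ _
  restrict-parity false f k eq rewrite eq = zeroˡ _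

  parity-resp : ∀ {p a b} → a ≋ b → HasParity p b → HasParity p a
  parity-resp a≋b par k eq = trans (a≋b k) (par k eq)

  U-even : HasParity true U
  U-even = parity-resp (ι-minus y 1#) (ι-even _)

  V-even : HasParity true V
  V-even = parity-resp (ι-minus 1# x) (ι-even _)

  system : (fₑ ≋ cosh β S.+ (fₑ ⊛ (V ⊛ versinh₂ β) S.+ fₒ ⊛ (X ⊛ sinh₂ β))) ×
           (fₒ ≋ U ⊛ sinh β S.+ (fₑ ⊛ sinh₂ β S.+ fₒ ⊛ (X ⊛ U ⊛ versinh₂ β)))
  system = parity-split
    (restrict-parity true bseq)
    (+-parity (cosh-even β) (+-parity
      (even⊛ fₑ-even (even⊛ V-even (versinh₂-even β)))
      (odd⊛ fₒ-odd (even⊛ (ι-even x) (sinh₂-odd β)))))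
    (restrict-parity false bseq)
    (+-parity (even⊛ U-even (sinh-odd β)) (+-parity
      (even⊛ fₑ-even (sinh₂-odd β))
      (odd⊛ fₒ-odd (even⊛ (even⊛ (ι-even x) U-even) (versinh₂-even β)))))
    -- `total` is the relation for the whole sequence; `collect` groups its right side into an even
    -- and an odd series.
    (S.trans total (collect fₑ fₒ (cosh β) (U ⊛ sinh β) (versinh₂ β) (sinh₂ β) X U V))
    where
    fₑ-even : HasParity true fₑ
    fₑ-even = restrict-parity true bseq

    fₒ-odd : HasParity false fₒ
    fₒ-odd = restrict-parity false bseq

    total : fₑ S.+ fₒ ≋ (cosh β S.+ U ⊛ sinh β) S.+
            (fₑ ⊛ (V ⊛ versinh₂ β S.+ sinh₂ β) S.+ fₒ ⊛ (X ⊛ U ⊛ versinh₂ β S.+ X ⊛ sinh₂ β))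
    total k = trans (restrict-sum bseq k) (trans (bseq-lastBlock k) (+-cong
      (trans (links-coshsinh true k) (+-congˡ (sym (U-⊛ (sinh β) k))))
      (+-cong (⊛-cong {a = fₑ} (λ _ → refl) block-true k) (⊛-cong {a = fₒ} (λ _ → refl) block-false k))))

  denominator : Seq
  denominator = X S.+ Y S.- (S.1# S.+ X ⊛ Y) ⊛ cosh₂ β

  private
    toUV : ∀ a → ι β ⊛ a ≋ U ⊛ V ⊛ a
    toUV a = ⊛-cong {b = a} ιβ≋UV (λ _ → refl)

    module Solution = LinearSystem
      {X} {Y} {fₑ} {fₒ} {cosh β} {sinh β} {cosh₂ β} {sinh₂ β} {versinh₂ β}
      (proj₁ system) (proj₂ system)
      (S.trans (S.sym (toUV (versinh₂ β))) (β-versinh₂ β))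
      (S.trans (S.+-congˡ {cosh₂ β ⊛ cosh₂ β} (S.-‿cong (S.sym (toUV (sinh₂ β ⊛ sinh₂ β))))) (cosh₂²-sinh₂² β))
      (S.trans (S.+-congˡ {cosh β ⊛ cosh₂ β} (S.-‿cong (S.sym (toUV (sinh β ⊛ sinh₂ β))))) (cosh-subtraction β))
      (sinh-subtraction β)

  fₑ-denominator : fₑ ⊛ denominator ≋ ι β ⊛ cosh β
  fₑ-denominator = S.trans Solution.even-part (S.sym (toUV (cosh β)))

  fₒ-denominator : fₒ ⊛ denominator ≋ (S.1# S.+ Y) ⊛ (ι β ⊛ sinh β)
  fₒ-denominator = S.trans Solution.odd-part (S.*-congˡ {S.1# S.+ Y} (S.sym (toUV (sinh β))))

  -- Comparison with the stated series.

  natR-2^ : ∀ k → natR R (2 ^ k) ≈ pow R 2# k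
  natR-2^ zero    = +-identityʳ 1#
  natR-2^ (suc k) = begin
    natR R (2 ^ k ℕ.+ (2 ^ k ℕ.+ 0))               ≈⟨ trans (natR-+ (2 ^ k) _) (+-congˡ (natR-+ (2 ^ k) 0)) ⟩
    natR R (2 ^ k) + (natR R (2 ^ k) + 0#)         ≈⟨ solve 1 (λ a → a :+ (a :+ con (+ 0)) := con (+ 2) :* a) refl _ ⟩
    2# * natR R (2 ^ k)                            ≈⟨ *-congˡ (natR-2^ k) ⟩
    2# * pow R 2# k                                ∎

  cosLike2≋ : cosLike2 R x y ≋ cosh₂ β
  cosLike2≋ k with isEven k | cosh-pow β k
  ... | true  | eq = *-cong (natR-2^ k) (sym eq)
  ... | false | eq = sym (trans (*-congˡ eq) (zeroʳ _))

  cosLike1≋ : cosLike1 R x y ≋ ι β ⊛ cosh β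
  cosLike1≋ k = trans (at k) (sym (ι-⊛ β (cosh β) k))
    where
    at : ∀ k → cosLike1 R x y k ≈ β * cosh β k
    at k with isEven k | cosh-pow β k
    ... | true  | eq = *-congˡ (sym eq)
    ... | false | eq = sym (trans (*-congˡ eq) (zeroʳ _))

  sinLike1≋ : sinLike1 R x y ≋ ι β ⊛ sinh β
  sinLike1≋ k = trans (at k) (sym (ι-⊛ β (sinh β) k))
    where
    at : ∀ k → sinLike1 R x y k ≈ β * sinh β k
    at k with isEven k | sinh-pow β k
    ... | true  | eq = sym (trans (*-congˡ eq) (zeroʳ _))
    ... | false | eq = *-congˡ (sym eq)

  ι-+ : ∀ a b → ι (a + b) ≋ ι a S.+ ι b
  ι-+ a b zero    = refl
  ι-+ a b (suc k) = sym (+-identityˡ 0#)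

  ι-* : ∀ a b → ι (a * b) ≋ ι a ⊛ ι b
  ι-* a b k = trans (at k) (sym (ι-⊛ a (ι b) k))
    where
    at : ∀ k → ι (a * b) k ≈ a * ι b k
    at zero    = refl
    at (suc k) = sym (zeroʳ a)

  1+xy-cosLike2 : (λ k → (1# + x * y) * cosLike2 R x y k) ≋ (S.1# S.+ X ⊛ Y) ⊛ cosh₂ β
  1+xy-cosLike2 k = trans (*-congˡ (cosLike2≋ k)) (sym (trans
    (⊛-cong {b = cosh₂ β} (S.trans (S.+-congˡ {S.1#} (S.sym (ι-* x y))) (S.sym (ι-+ 1# (x * y)))) (λ _ → refl) k)
    (ι-⊛ (1# + x * y) (cosh₂ β) k)))

  denom≋ : denom R x y ≋ denominator
  denom≋ k = +-cong (ι-+ x y k) (-‿cong (1+xy-cosLike2 k))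

  -- The subtracted denominator accounts for the constant term 1 that separates `fₑ` from `evenB`.
  numEven≋ : numEven R x y ≋ ι β ⊛ cosh β S.- denominator
  numEven≋ k = trans
    (+-cong (+-cong (1+xy-cosLike2 k) (cosLike1≋ k)) (-‿cong (ι-+ x y k)))
    (solve 3 (λ p q s → p :+ q :- s := q :- (s :- p)) refl _ _ _)

  numOdd≋ : numOdd R x y ≋ (S.1# S.+ Y) ⊛ (ι β ⊛ sinh β)
  numOdd≋ k = trans (*-congˡ (sinLike1≋ k)) (sym (trans
    (⊛-cong {b = ι β ⊛ sinh β} (S.sym (ι-+ 1# y)) (λ _ → refl) k) (ι-⊛ (1# + y) _ k)))

  evenB≋ : evenB R x y ≋ fₑ S.- S.1#
  -- The empty signed permutation contributes 1 to `fₑ`, while the stated sum starts at n = 1.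
  evenB≋ zero    = solve 0 (con (+ 0) := con (+ 1) :* con (+ 1) :- con (+ 1)) refl
  evenB≋ (suc k) with isEven (suc k)
  ... | true  = trans (Bhat≋bseq (suc k)) (solve 1 (λ a → a := con (+ 1) :* a :- con (+ 0)) refl _)
  ... | false = solve 1 (λ a → con (+ 0) := con (+ 0) :* a :- con (+ 0)) refl _

  oddB≋ : oddB R x y ≋ fₒ
  oddB≋ k with isEven k
  ... | true  = sym (zeroˡ _)
  ... | false = trans (Bhat≋bseq k) (sym (*-identityˡ _))

  even-identity : egfMul R (evenB R x y) (denom R x y) ≋ numEven R x y
  even-identity = S.trans (egfMul≋⊛ _ _) (S.trans (⊛-cong evenB≋ denom≋) (S.trans
    (pred-* fₑ denominator)
    (S.trans (S.+-congʳ fₑ-denominator) (S.sym numEven≋))))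

  odd-identity : egfMul R (oddB R x y) (denom R x y) ≋ numOdd R x y
  odd-identity = S.trans (egfMul≋⊛ _ _) (S.trans (⊛-cong oddB≋ denom≋)
    (S.trans fₒ-denominator (S.sym numOdd≋)))

theorem1p3 : {c ℓ : Level} (R : CommutativeRing c ℓ) (x y : CommutativeRing.Carrier R) →
    ((N : ℕ) → CommutativeRing._≈_ R (egfMul R (evenB R x y) (denom R x y) N) (numEven R x y N))
    × ((N : ℕ) → CommutativeRing._≈_ R (egfMul R (oddB R x y) (denom R x y) N) (numOdd R x y N))
theorem1p3 R x y = even-identity , odd-identity
  where
  open GeneratingFunctions R x y
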